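{- Let $\lambda$ be a nonzero real number, $x$ real, and $n\ge0$ an integer. Then $$\beta_{n,\lambda}(x)=\sum_{k=0}^{n}k!\,S_{2,\lambda}(n,k)\sum_{j=0}^{k}\binom{x}{j}\frac{\lambda^{k-j}}{(k-j+1)!}(1)_{k-j+1,\frac{1}{\lambda}}.$$ In particular, for $x=0$, $$\beta_{n,\lambda}=\sum_{k=0}^{n}k!\,S_{2,\lambda}(n,k)\frac{\lambda^{k}}{(k+1)!}(1)_{k+1,\frac{1}{\lambda}}.$$
   Context: For real $y$, $\mu\neq 0$ and integer $k\ge0$: $(y)_{0,\mu}=1$, $(y)_{k,\mu}=y(y-\mu)\cdots(y-(k-1)\mu)$ (used with $\mu=\lambda$ and $\mu=1/\lambda$); $(y)_0=1$, $(y)_k=y(y-1)\cdots(y-k+1)$. The degenerate exponential is $e_\lambda^x(t)=\sum_{k\ge0}(x)_{k,\lambda}t^k/k!=(1+\lambda t)^{x/\lambda}$, $e_\lambda(t)=e^1_\lambda(t)$. The degenerate Bernoulli polynomials are defined by $\frac{t}{e_\lambda(t)-1}e_\lambda^x(t)=\sum_{n\ge0}\beta_{n,\lambda}(x)\frac{t^n}{n!}$, and $\beta_{n,\lambda}=\beta_{n,\lambda}(0)$. The degenerate Stirling numbers of the second kind are defined by $(x)_{n,\lambda}=\sum_{k=0}^{n}S_{2,\lambda}(n,k)(x)_{k}$ ($n\ge0$). -}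

module Defs where

open import Algebra.Bundles using (CommutativeRing)
import Algebra.Properties.CommutativeSemigroup as CommutativeSemigroupProperties
import Algebra.Properties.Ring as RingProperties
open import Algebra.Structures using (IsCommutativeRing)
open import Data.Fin.Base as Fin using (Fin; toℕ)
open import Data.Fin.Properties using (toℕ-inject₁; toℕ-fromℕ)
open import Data.Integer.Base using (+_)
open import Data.Nat.Base as ℕ using (ℕ; zero; suc; _∸_; _⊔_; _⊓_; _!)
import Data.Nat.Properties as ℕ
open import Data.Product.Base using (∃; ∃-syntax; _×_; _,_; proj₁; proj₂; uncurry)
open import Data.Rational.Base as ℚ using (ℚ; 0ℚ; 1ℚ; ½; ∣_∣)
import Data.Rational.Properties as ℚ
open import Data.Rational.Solver using (module +-*-Solver)
open import Data.Vec.Base using (Vec; []; _∷_; head; lookup)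
open import Function.Base using (id; _∘_)
open import Level using (0ℓ)
open import Relation.Binary.PropositionalEquality as ≡ using (_≡_; _≢_; cong; cong₂; subst)
import Relation.Binary.Reasoning.Setoid as ≈-Reasoning
open import Relation.Nullary.Decidable using (yes; no)
open import Relation.Nullary.Negation using (¬_; contradiction)

------------------------------------------------------------------------
-- Null families of rationals.  The height function h turns I into a
-- directed index set: I = ℕ with h = id for sequences, and I = ℕ × ℕ
-- with h = uncurry _⊓_ for double sequences.

Eventually : {I : Set} → (I → ℕ) → (I → Set) → Set
Eventually {I} h P = ∃[ N ] ((i : I) → N ℕ.≤ h i → P i)

record Null {I : Set} (h : I → ℕ) (f : I → ℚ) : Set where
  constructor mkNull
  field
    small : ∀ ε → 0ℚ ℚ.< ε → Eventually h (λ i → ∣ f i ∣ ℚ.< ε)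

record Bounded {I : Set} (h : I → ℕ) (f : I → ℚ) : Set where
  constructor mkBounded
  field
    B     : ℚ
    B>0   : 0ℚ ℚ.< B
    bound : Eventually h (λ i → ∣ f i ∣ ℚ.≤ B)

module _ {I : Set} {h : I → ℕ} where

  both : {P Q : I → Set} → Eventually h P → Eventually h Q → Eventually h (λ i → P i × Q i)
  both (M , p) (N , q) = M ⊔ N , λ i le →
    p i (ℕ.≤-trans (ℕ.m≤m⊔n M N) le) , q i (ℕ.≤-trans (ℕ.m≤n⊔m M N) le)

  eventually-map : {P Q : I → Set} → (∀ i → P i → Q i) → Eventually h P → Eventually h Q
  eventually-map g (N , p) = N , λ i le → g i (p i le)

  null-resp : {f g : I → ℚ} → Eventually h (λ i → f i ≡ g i) → Null h f → Null h g
  null-resp e (mkNull nf) = mkNull λ ε ε>0 →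
    eventually-map (λ i (eq , lt) → subst (λ q → ∣ q ∣ ℚ.< ε) eq lt) (both e (nf ε ε>0))

  null-cong : {f g : I → ℚ} → (∀ i → f i ≡ g i) → Null h f → Null h g
  null-cong e = null-resp (0 , λ i _ → e i)

  null-0 : Null h (λ _ → 0ℚ)
  null-0 = mkNull λ ε ε>0 → 0 , λ _ _ → ε>0

  null-neg : {f : I → ℚ} → Null h f → Null h (λ i → ℚ.- f i)
  null-neg {f} (mkNull nf) = mkNull λ ε ε>0 →
    eventually-map (λ i → subst (ℚ._< ε) (≡.sym (ℚ.∣-p∣≡∣p∣ (f i)))) (nf ε ε>0)

  null-+ : {f g : I → ℚ} → Null h f → Null h g → Null h (λ i → f i ℚ.+ g i)
  null-+ {f} {g} (mkNull nf) (mkNull ng) = mkNull sum-small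
   where
   sum-small : ∀ ε → 0ℚ ℚ.< ε → Eventually h (λ i → ∣ f i ℚ.+ g i ∣ ℚ.< ε)
   sum-small ε ε>0 = eventually-map step (both (nf (½ ℚ.* ε) ½ε>0) (ng (½ ℚ.* ε) ½ε>0))
    where
    ½ε>0 : 0ℚ ℚ.< ½ ℚ.* ε
    ½ε>0 = subst (ℚ._< ½ ℚ.* ε) (ℚ.*-zeroʳ ½) (ℚ.*-monoʳ-<-pos ½ ε>0)
    halves : ½ ℚ.* ε ℚ.+ ½ ℚ.* ε ≡ ε
    halves = ≡.trans (≡.sym (ℚ.*-distribʳ-+ ε ½ ½)) (ℚ.*-identityˡ ε)
    step : ∀ i → (∣ f i ∣ ℚ.< ½ ℚ.* ε) × (∣ g i ∣ ℚ.< ½ ℚ.* ε) → ∣ f i ℚ.+ g i ∣ ℚ.< ε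
    step i (p , q) = ℚ.≤-<-trans (ℚ.∣p+q∣≤∣p∣+∣q∣ (f i) (g i))
      (subst (∣ f i ∣ ℚ.+ ∣ g i ∣ ℚ.<_) halves (ℚ.+-mono-< p q))

  null-* : {f g : I → ℚ} → Null h f → Bounded h g → Null h (λ i → f i ℚ.* g i)
  null-* {f} {g} (mkNull nf) (mkBounded B B>0 bg) = mkNull product-small
   where
   product-small : ∀ ε → 0ℚ ℚ.< ε → Eventually h (λ i → ∣ f i ℚ.* g i ∣ ℚ.< ε)
   product-small ε ε>0 = eventually-map step (both (nf (ε ℚ.* B⁻¹) ε/B>0) bg)
    where
    instance
      posB : ℚ.Positive B
      posB = ℚ.positive B>0
      nzB : ℚ.NonZero B
      nzB = ℚ.pos⇒nonZero B
      posε : ℚ.Positive ε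
      posε = ℚ.positive ε>0
    B⁻¹ : ℚ
    B⁻¹ = ℚ.1/ B
    ε/B>0 : 0ℚ ℚ.< ε ℚ.* B⁻¹
    ε/B>0 = ℚ.positive⁻¹ (ε ℚ.* B⁻¹) {{ℚ.pos*pos⇒pos ε B⁻¹ {{ℚ.1/pos⇒pos B}}}}
    cancel : ε ℚ.* B⁻¹ ℚ.* B ≡ ε
    cancel = ≡.trans (ℚ.*-assoc ε B⁻¹ B)
      (≡.trans (cong (ε ℚ.*_) (ℚ.*-inverseˡ B)) (ℚ.*-identityʳ ε))
    step : ∀ i → (∣ f i ∣ ℚ.< ε ℚ.* B⁻¹) × (∣ g i ∣ ℚ.≤ B) → ∣ f i ℚ.* g i ∣ ℚ.< ε
    step i (p , q) = subst (ℚ._< ε) (≡.sym (ℚ.∣p*q∣≡∣p∣*∣q∣ (f i) (g i)))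
      (ℚ.≤-<-trans
        (ℚ.*-monoˡ-≤-nonNeg ∣ f i ∣ {{ℚ.∣-∣-nonNeg (f i)}} q)
        (subst (∣ f i ∣ ℚ.* B ℚ.<_) cancel (ℚ.*-monoˡ-<-pos B p)))

  bounded-* : {f g : I → ℚ} → Bounded h f → Bounded h g → Bounded h (λ i → f i ℚ.* g i)
  bounded-* {f} {g} (mkBounded B B>0 bf) (mkBounded C C>0 bg) = mkBounded (B ℚ.* C)
    (ℚ.positive⁻¹ (B ℚ.* C) {{ℚ.pos*pos⇒pos B {{ℚ.positive B>0}} C {{ℚ.positive C>0}}}})
    (eventually-map step (both bf bg))
    where
    step : ∀ i → (∣ f i ∣ ℚ.≤ B) × (∣ g i ∣ ℚ.≤ C) → ∣ f i ℚ.* g i ∣ ℚ.≤ B ℚ.* C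
    step i (p , q) = subst (ℚ._≤ B ℚ.* C) (≡.sym (ℚ.∣p*q∣≡∣p∣*∣q∣ (f i) (g i)))
      (ℚ.≤-trans
        (ℚ.*-monoˡ-≤-nonNeg ∣ f i ∣ {{ℚ.∣-∣-nonNeg (f i)}} q)
        (ℚ.*-monoʳ-≤-nonNeg C {{ℚ.pos⇒nonNeg C {{ℚ.positive C>0}}}} p))

------------------------------------------------------------------------
-- The real numbers: Cauchy sequences of rationals, with equality of
-- limits as setoid equality.

IsCauchy : (ℕ → ℚ) → Set
IsCauchy s = ∀ ε → 0ℚ ℚ.< ε → ∃[ N ] (∀ m n → N ℕ.≤ m → N ℕ.≤ n → ∣ s m ℚ.- s n ∣ ℚ.< ε)

record ℝ : Set where
  constructor mkℝ
  field
    seq    : ℕ → ℚ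
    cauchy : IsCauchy seq

open ℝ public

infix 4 _≈_ _#_

record _≈_ (x y : ℝ) : Set where
  constructor mk≈
  field
    null : Null id (λ n → seq x n ℚ.- seq y n)

-- Apartness, the constructive reading of x ≠ y: an inverse of x can only
-- be constructed from x # 0.  By #⇒≉ and #-tight, x # y is classically
-- equivalent to ¬ (x ≈ y).
record _#_ (x y : ℝ) : Set where
  constructor mk#
  field
    δ     : ℚ
    δ>0   : 0ℚ ℚ.< δ
    apart : Eventually id (λ n → δ ℚ.≤ ∣ seq x n ℚ.- seq y n ∣)

fromNull : (s : ℕ → ℚ) → Null (uncurry _⊓_) (λ (m , n) → s m ℚ.- s n) → ℝ
fromNull s (mkNull p) = mkℝ s λ ε ε>0 →
  proj₁ (p ε ε>0) , λ m n N≤m N≤n → proj₂ (p ε ε>0) (m , n) (ℕ.⊓-glb N≤m N≤n)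

cauchy-null : ∀ x → Null (uncurry _⊓_) (λ (m , n) → seq x m ℚ.- seq x n)
cauchy-null x = mkNull λ ε ε>0 → proj₁ (cauchy x ε ε>0) , λ (m , n) le →
  proj₂ (cauchy x ε ε>0) m n (ℕ.≤-trans le (ℕ.m⊓n≤m m n)) (ℕ.≤-trans le (ℕ.m⊓n≤n m n))

bounded : ∀ x → Bounded id (seq x)
bounded (mkℝ s c) = mkBounded B B>0 (N , bound)
  where
  N : ℕ
  N = proj₁ (c 1ℚ (ℚ.positive⁻¹ 1ℚ))
  B : ℚ
  B = 1ℚ ℚ.+ ∣ s N ∣
  B>0 : 0ℚ ℚ.< B
  B>0 = ℚ.positive⁻¹ B {{ℚ.pos+nonNeg⇒pos 1ℚ ∣ s N ∣ {{ℚ.∣-∣-nonNeg (s N)}}}}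
  split : ∀ a b → a ℚ.- b ℚ.+ b ≡ a
  split = solve 2 (λ a b → a :- b :+ b := a) ≡.refl where open +-*-Solver
  bound : ∀ n → N ℕ.≤ n → ∣ s n ∣ ℚ.≤ B
  bound n N≤n = ℚ.≤-trans
    (subst (λ q → ∣ q ∣ ℚ.≤ ∣ s n ℚ.- s N ∣ ℚ.+ ∣ s N ∣) (split (s n) (s N))
      (ℚ.∣p+q∣≤∣p∣+∣q∣ (s n ℚ.- s N) (s N)))
    (ℚ.+-monoˡ-≤ ∣ s N ∣ (ℚ.<⇒≤ (proj₂ (c 1ℚ (ℚ.positive⁻¹ 1ℚ)) n N N≤n ℕ.≤-refl)))

eventually₁ : {P : ℕ → Set} → Eventually id P → Eventually (uncurry _⊓_) (P ∘ proj₁)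
eventually₁ (N , b) = N , λ (m , n) le → b m (ℕ.≤-trans le (ℕ.m⊓n≤m m n))

eventually₂ : {P : ℕ → Set} → Eventually id P → Eventually (uncurry _⊓_) (P ∘ proj₂)
eventually₂ (N , b) = N , λ (m , n) le → b n (ℕ.≤-trans le (ℕ.m⊓n≤n m n))

bounded₁ : ∀ {s} → Bounded id s → Bounded (uncurry _⊓_) (s ∘ proj₁)
bounded₁ (mkBounded B B>0 e) = mkBounded B B>0 (eventually₁ e)

bounded₂ : ∀ {s} → Bounded id s → Bounded (uncurry _⊓_) (s ∘ proj₂)
bounded₂ (mkBounded B B>0 e) = mkBounded B B>0 (eventually₂ e)

mul-diff : ∀ a b c d → (a ℚ.- c) ℚ.* b ℚ.+ (b ℚ.- d) ℚ.* c ≡ a ℚ.* b ℚ.- c ℚ.* d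
mul-diff = solve 4 (λ a b c d → (a :- c) :* b :+ (b :- d) :* c := a :* b :- c :* d) ≡.refl
  where open +-*-Solver

add-diff : ∀ a b c d → (a ℚ.- c) ℚ.+ (b ℚ.- d) ≡ (a ℚ.+ b) ℚ.- (c ℚ.+ d)
add-diff = solve 4 (λ a b c d → (a :- c) :+ (b :- d) := (a :+ b) :- (c :+ d)) ≡.refl
  where open +-*-Solver

neg-diff : ∀ a b → ℚ.- (a ℚ.- b) ≡ (ℚ.- a) ℚ.- (ℚ.- b)
neg-diff = solve 2 (λ a b → :- (a :- b) := (:- a) :- (:- b)) ≡.refl
  where open +-*-Solver

-- Totalised reciprocal, with inv₀ 0 = 0.
inv₀ : ℚ → ℚ
inv₀ q with q ℚ.≟ 0ℚ
... | yes _  = 0ℚ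
... | no q≢0 = ℚ.1/_ q {{ℚ.≢-nonZero q≢0}}

inv₀-inverse : ∀ {q} → q ≢ 0ℚ → q ℚ.* inv₀ q ≡ 1ℚ
inv₀-inverse {q} q≢0 with q ℚ.≟ 0ℚ
... | yes q≡0 = contradiction q≡0 q≢0
... | no q≢0′ = ℚ.*-inverseʳ q {{ℚ.≢-nonZero q≢0′}}

away⇒≢0 : ∀ {δ q} → 0ℚ ℚ.< δ → δ ℚ.≤ ∣ q ∣ → q ≢ 0ℚ
away⇒≢0 δ>0 δ≤ ≡.refl = ℚ.<-irrefl ≡.refl (ℚ.<-≤-trans δ>0 δ≤)

away : ∀ x {δ} → Eventually id (λ n → δ ℚ.≤ ∣ seq x n ℚ.- 0ℚ ∣) →
       Eventually id (λ n → δ ℚ.≤ ∣ seq x n ∣)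
away x {δ} = eventually-map (λ n → subst (λ q → δ ℚ.≤ ∣ q ∣) (ℚ.+-identityʳ (seq x n)))

inv₀-bounded : ∀ {s δ} → 0ℚ ℚ.< δ → Eventually id (λ n → δ ℚ.≤ ∣ s n ∣) → Bounded id (inv₀ ∘ s)
inv₀-bounded {s} {δ} δ>0 e = mkBounded B B>0 (eventually-map step e)
  where
  instance
    posδ : ℚ.Positive δ
    posδ = ℚ.positive δ>0
    nzδ : ℚ.NonZero δ
    nzδ = ℚ.pos⇒nonZero δ
  B : ℚ
  B = ℚ.1/ δ
  B>0 : 0ℚ ℚ.< B
  B>0 = ℚ.positive⁻¹ B {{ℚ.1/pos⇒pos δ}}
  step : ∀ n → δ ℚ.≤ ∣ s n ∣ → ∣ inv₀ (s n) ∣ ℚ.≤ B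
  step n δ≤ = ℚ.*-cancelˡ-≤-pos δ (begin
    δ ℚ.* ∣ inv₀ (s n) ∣       ≤⟨ ℚ.*-monoʳ-≤-nonNeg ∣ inv₀ (s n) ∣ {{ℚ.∣-∣-nonNeg (inv₀ (s n))}} δ≤ ⟩
    ∣ s n ∣ ℚ.* ∣ inv₀ (s n) ∣ ≡⟨ ℚ.∣p*q∣≡∣p∣*∣q∣ (s n) (inv₀ (s n)) ⟨
    ∣ s n ℚ.* inv₀ (s n) ∣     ≡⟨ cong ∣_∣ (inv₀-inverse (away⇒≢0 δ>0 δ≤)) ⟩
    1ℚ                         ≡⟨ ℚ.*-inverseʳ δ ⟨
    δ ℚ.* B                    ∎)
    where open ℚ.≤-Reasoning

inv₀-diff : ∀ {a b} → a ≢ 0ℚ → b ≢ 0ℚ →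
            ℚ.- (a ℚ.- b) ℚ.* (inv₀ a ℚ.* inv₀ b) ≡ inv₀ a ℚ.- inv₀ b
inv₀-diff {a} {b} a≢0 b≢0 = begin
  ℚ.- (a ℚ.- b) ℚ.* (inv₀ a ℚ.* inv₀ b)
    ≡⟨ regroup a b (inv₀ a) (inv₀ b) ⟩
  (b ℚ.* inv₀ b) ℚ.* inv₀ a ℚ.- (a ℚ.* inv₀ a) ℚ.* inv₀ b
    ≡⟨ cong₂ (λ p q → p ℚ.* inv₀ a ℚ.- q ℚ.* inv₀ b) (inv₀-inverse b≢0) (inv₀-inverse a≢0) ⟩
  1ℚ ℚ.* inv₀ a ℚ.- 1ℚ ℚ.* inv₀ b
    ≡⟨ cong₂ ℚ._-_ (ℚ.*-identityˡ (inv₀ a)) (ℚ.*-identityˡ (inv₀ b)) ⟩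
  inv₀ a ℚ.- inv₀ b ∎
  where
  open ≡.≡-Reasoning
  regroup : ∀ a b p q → ℚ.- (a ℚ.- b) ℚ.* (p ℚ.* q) ≡ (b ℚ.* q) ℚ.* p ℚ.- (a ℚ.* p) ℚ.* q
  regroup = solve 4 (λ a b p q → (:- (a :- b)) :* (p :* q) := (b :* q) :* p :- (a :* p) :* q) ≡.refl
    where open +-*-Solver

infix  8 -_
infixl 7 _*_
infixl 6 _+_ _-_

opaque

  fromℚ : ℚ → ℝ
  fromℚ q = fromNull (λ _ → q) (null-cong (λ _ → ≡.sym (ℚ.+-inverseʳ q)) null-0)

  _+_ : ℝ → ℝ → ℝ
  x + y = fromNull (λ n → seq x n ℚ.+ seq y n)
    (null-cong (λ (m , n) → add-diff (seq x m) (seq y m) (seq x n) (seq y n))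
      (null-+ (cauchy-null x) (cauchy-null y)))

  -_ : ℝ → ℝ
  - x = fromNull (λ n → ℚ.- seq x n)
    (null-cong (λ (m , n) → neg-diff (seq x m) (seq x n)) (null-neg (cauchy-null x)))

  _*_ : ℝ → ℝ → ℝ
  x * y = fromNull (λ n → seq x n ℚ.* seq y n)
    (null-cong (λ (m , n) → mul-diff (seq x m) (seq y m) (seq x n) (seq y n))
      (null-+ (null-* (cauchy-null x) (bounded₁ (bounded y)))
              (null-* (cauchy-null y) (bounded₂ (bounded x)))))

0ℝ 1ℝ : ℝ
0ℝ = fromℚ 0ℚ
1ℝ = fromℚ 1ℚ

_-_ : ℝ → ℝ → ℝ
x - y = x + (- y)

opaque
  unfolding fromℚ

  inverse : (x : ℝ) → x # 0ℝ → ℝ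
  inverse x (mk# δ δ>0 e) = fromNull (inv₀ ∘ seq x)
    (null-resp
      (eventually-map (λ (m , n) (p , q) → inv₀-diff (away⇒≢0 δ>0 p) (away⇒≢0 δ>0 q))
        (both (eventually₁ x-away) (eventually₂ x-away)))
      (null-* (null-neg (cauchy-null x))
        (bounded-* (bounded₁ (inv₀-bounded δ>0 x-away)) (bounded₂ (inv₀-bounded δ>0 x-away)))))
    where
    x-away : Eventually id (λ n → δ ℚ.≤ ∣ seq x n ∣)
    x-away = away x e

pointwise : ∀ {x y} → (∀ n → seq x n ≡ seq y n) → x ≈ y
pointwise {x} {y} e = mk≈ (null-cong
  (λ n → ≡.sym (≡.trans (cong (ℚ._- seq y n) (e n)) (ℚ.+-inverseʳ (seq y n)))) null-0)

opaque
  unfolding fromℚ _+_ -_ _*_ inverse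

  fromℚ-+ : ∀ p q → fromℚ (p ℚ.+ q) ≈ fromℚ p + fromℚ q
  fromℚ-+ p q = pointwise λ _ → ≡.refl

  fromℚ-* : ∀ p q → fromℚ (p ℚ.* q) ≈ fromℚ p * fromℚ q
  fromℚ-* p q = pointwise λ _ → ≡.refl

  inverseʳ : ∀ x (x#0 : x # 0ℝ) → x * inverse x x#0 ≈ 1ℝ
  inverseʳ x (mk# δ δ>0 e) = mk≈ (null-resp
    (eventually-map (λ n δ≤ → ≡.sym (cong (ℚ._- 1ℚ) (inv₀-inverse (away⇒≢0 δ>0 δ≤)))) (away x e))
    null-0)

  #⇒≉ : ∀ {x y} → x # y → ¬ (x ≈ y)
  #⇒≉ (mk# δ δ>0 p) (mk≈ (mkNull q)) with both {h = id} p (q δ δ>0)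
  ... | N , pq = ℚ.<-irrefl ≡.refl (ℚ.≤-<-trans (proj₁ (pq N ℕ.≤-refl)) (proj₂ (pq N ℕ.≤-refl)))

  #-tight : ∀ {x y} → ¬ (x # y) → x ≈ y
  #-tight {x} {y} ¬x#y = mk≈ (mkNull close)
    where
    d : ℝ
    d = x + (- y)
    close : ∀ ε → 0ℚ ℚ.< ε → Eventually id (λ n → ∣ seq d n ∣ ℚ.< ε)
    close ε ε>0 = N , λ n N≤n → dec n N≤n
      where
      open ℚ.≤-Reasoning
      η : ℚ
      η = ½ ℚ.* ε
      η>0 : 0ℚ ℚ.< η
      η>0 = subst (ℚ._< η) (ℚ.*-zeroʳ ½) (ℚ.*-monoʳ-<-pos ½ ε>0)
      halves : η ℚ.+ η ≡ ε
      halves = ≡.trans (≡.sym (ℚ.*-distribʳ-+ ε ½ ½)) (ℚ.*-identityˡ ε)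
      N : ℕ
      N = proj₁ (cauchy d η η>0)
      split : ∀ a b → a ℚ.- b ℚ.+ b ≡ a
      split = solve 2 (λ a b → a :- b :+ b := a) ≡.refl where open +-*-Solver
      far : ∀ n → N ℕ.≤ n → ε ℚ.≤ ∣ seq d n ∣ → ∀ m → N ℕ.≤ m → η ℚ.≤ ∣ seq d m ∣
      far n N≤n ε≤ m N≤m = ℚ.≮⇒≥ λ small → ℚ.<-irrefl ≡.refl (begin-strict
        ε                                             ≤⟨ ε≤ ⟩
        ∣ seq d n ∣                                   ≡⟨ cong ∣_∣ (split (seq d n) (seq d m)) ⟨
        ∣ seq d n ℚ.- seq d m ℚ.+ seq d m ∣           ≤⟨ ℚ.∣p+q∣≤∣p∣+∣q∣ (seq d n ℚ.- seq d m) (seq d m) ⟩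
        ∣ seq d n ℚ.- seq d m ∣ ℚ.+ ∣ seq d m ∣       <⟨ ℚ.+-mono-< (proj₂ (cauchy d η η>0) n m N≤n N≤m) small ⟩
        η ℚ.+ η                                       ≡⟨ halves ⟩
        ε                                             ∎)
      dec : ∀ n → N ℕ.≤ n → ∣ seq d n ∣ ℚ.< ε
      dec n N≤n with ∣ seq d n ∣ ℚ.<? ε
      ... | yes lt = lt
      ... | no ¬lt = contradiction (mk# η η>0 (N , far n N≤n (ℚ.≮⇒≥ ¬lt))) ¬x#y

  ≈-refl : ∀ {x} → x ≈ x
  ≈-refl = pointwise λ _ → ≡.refl

  ≈-sym : ∀ {x y} → x ≈ y → y ≈ x
  ≈-sym {x} {y} (mk≈ p) = mk≈ (null-cong (λ n → flip (seq x n) (seq y n)) (null-neg p))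
    where
    flip : ∀ a b → ℚ.- (a ℚ.- b) ≡ b ℚ.- a
    flip = solve 2 (λ a b → :- (a :- b) := b :- a) ≡.refl where open +-*-Solver

  ≈-trans : ∀ {x y z} → x ≈ y → y ≈ z → x ≈ z
  ≈-trans {x} {y} {z} (mk≈ p) (mk≈ q) =
    mk≈ (null-cong (λ n → telescope (seq x n) (seq y n) (seq z n)) (null-+ p q))
    where
    telescope : ∀ a b c → (a ℚ.- b) ℚ.+ (b ℚ.- c) ≡ a ℚ.- c
    telescope = solve 3 (λ a b c → (a :- b) :+ (b :- c) := a :- c) ≡.refl where open +-*-Solver

  +-cong : ∀ {x x′ y y′} → x ≈ x′ → y ≈ y′ → x + y ≈ x′ + y′
  +-cong {x} {x′} {y} {y′} (mk≈ p) (mk≈ q) =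
    mk≈ (null-cong (λ n → add-diff (seq x n) (seq y n) (seq x′ n) (seq y′ n)) (null-+ p q))

  -‿cong : ∀ {x x′} → x ≈ x′ → - x ≈ - x′
  -‿cong {x} {x′} (mk≈ p) = mk≈ (null-cong (λ n → neg-diff (seq x n) (seq x′ n)) (null-neg p))

  *-cong : ∀ {x x′ y y′} → x ≈ x′ → y ≈ y′ → x * y ≈ x′ * y′
  *-cong {x} {x′} {y} {y′} (mk≈ p) (mk≈ q) =
    mk≈ (null-cong (λ n → mul-diff (seq x n) (seq y n) (seq x′ n) (seq y′ n))
      (null-+ (null-* p (bounded y)) (null-* q (bounded x′))))

  +-assoc : ∀ x y z → (x + y) + z ≈ x + (y + z)
  +-assoc x y z = pointwise λ n → ℚ.+-assoc (seq x n) (seq y n) (seq z n)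

  +-comm : ∀ x y → x + y ≈ y + x
  +-comm x y = pointwise λ n → ℚ.+-comm (seq x n) (seq y n)

  +-identityˡ : ∀ x → 0ℝ + x ≈ x
  +-identityˡ x = pointwise λ n → ℚ.+-identityˡ (seq x n)

  +-identityʳ : ∀ x → x + 0ℝ ≈ x
  +-identityʳ x = pointwise λ n → ℚ.+-identityʳ (seq x n)

  +-inverseˡ : ∀ x → - x + x ≈ 0ℝ
  +-inverseˡ x = pointwise λ n → ℚ.+-inverseˡ (seq x n)

  +-inverseʳ : ∀ x → x + (- x) ≈ 0ℝ
  +-inverseʳ x = pointwise λ n → ℚ.+-inverseʳ (seq x n)

  *-assoc : ∀ x y z → (x * y) * z ≈ x * (y * z)
  *-assoc x y z = pointwise λ n → ℚ.*-assoc (seq x n) (seq y n) (seq z n)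

  *-comm : ∀ x y → x * y ≈ y * x
  *-comm x y = pointwise λ n → ℚ.*-comm (seq x n) (seq y n)

  *-identityˡ : ∀ x → 1ℝ * x ≈ x
  *-identityˡ x = pointwise λ n → ℚ.*-identityˡ (seq x n)

  *-identityʳ : ∀ x → x * 1ℝ ≈ x
  *-identityʳ x = pointwise λ n → ℚ.*-identityʳ (seq x n)

  *-distribˡ-+ : ∀ x y z → x * (y + z) ≈ x * y + x * z
  *-distribˡ-+ x y z = pointwise λ n → ℚ.*-distribˡ-+ (seq x n) (seq y n) (seq z n)

  *-distribʳ-+ : ∀ x y z → (y + z) * x ≈ y * x + z * x
  *-distribʳ-+ x y z = pointwise λ n → ℚ.*-distribʳ-+ (seq x n) (seq y n) (seq z n)

isCommutativeRing : IsCommutativeRing _≈_ _+_ _*_ -_ 0ℝ 1ℝ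
isCommutativeRing = record
  { isRing = record
    { +-isAbelianGroup = record
      { isGroup = record
        { isMonoid = record
          { isSemigroup = record
            { isMagma = record
              { isEquivalence = record { refl = ≈-refl ; sym = ≈-sym ; trans = ≈-trans }
              ; ∙-cong = +-cong
              }
            ; assoc = +-assoc
            }
          ; identity = +-identityˡ , +-identityʳ
          }
        ; inverse = +-inverseˡ , +-inverseʳ
        ; ⁻¹-cong = -‿cong
        }
      ; comm = +-comm
      }
    ; *-cong = *-cong
    ; *-assoc = *-assoc
    ; *-identity = *-identityˡ , *-identityʳ
    ; distrib = *-distribˡ-+ , *-distribʳ-+
    }
  ; *-comm = *-comm
  }

ℝ-commutativeRing : CommutativeRing 0ℓ 0ℓ
ℝ-commutativeRing = record { isCommutativeRing = isCommutativeRing }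

private module R = CommutativeRing ℝ-commutativeRing

open import Algebra.Properties.Semiring.Exp R.semiring public using (_^_)
open import Algebra.Properties.Semiring.Sum R.semiring
  using (sum; sum-cong-≋; ∑-distrib-+; *-distribˡ-sum; *-distribʳ-sum; sum-init-last)

infixr 5 ∑-syntax

∑-syntax : ℕ → (ℕ → ℝ) → ℝ
∑-syntax n f = sum {suc n} (f ∘ toℕ)

syntax ∑-syntax n (λ k → e) = ∑[ k ≤ n ] e

fromℕ : ℕ → ℝ
fromℕ n = fromℚ (+ n ℚ./ 1)

1/_! : ℕ → ℝ
1/ n ! = fromℚ (ℚ._/_ (+ 1) (n !) {{n ℕ.!≢0}})

------------------------------------------------------------------------
-- Falling factorials: degFalling y k μ is (y)_{k,μ}, falling y k is (y)_k.

degFalling : ℝ → ℕ → ℝ → ℝ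
degFalling y zero    μ = 1ℝ
degFalling y (suc k) μ = degFalling y k μ * (y - fromℕ k * μ)

falling : ℝ → ℕ → ℝ
falling y zero    = 1ℝ
falling y (suc k) = falling y k * (y - fromℕ k)

binomial : ℝ → ℕ → ℝ
binomial x j = falling x j * 1/ j !

------------------------------------------------------------------------
-- Formal power series over ℝ, as coefficient sequences.

Series : Set
Series = ℕ → ℝ

infix  4 _≋_
infixl 7 _⊛_
infixl 6 _⊖_

_≋_ : Series → Series → Set
a ≋ b = ∀ n → a n ≈ b n

one : Series
one zero    = 1ℝ
one (suc _) = 0ℝ

t : Series
t (suc zero) = 1ℝ
t _          = 0ℝ

_⊖_ : Series → Series → Series
(a ⊖ b) n = a n - b n

_⊛_ : Series → Series → Series
(a ⊛ b) n = ∑[ k ≤ n ] a k * b (n ∸ k)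

divide-by-t : Series → Series
divide-by-t a n = a (suc n)

-- reciprocals a n = b n ∷ … ∷ b 0 ∷ [], where b is determined by b 0 = 1
-- and b (n + 1) = - ∑[ k ≤ n ] a (k + 1) * b (n - k); if a 0 = 1, then b
-- is the multiplicative inverse of a.
reciprocals : Series → (n : ℕ) → Vec ℝ (suc n)
reciprocals a zero    = 1ℝ ∷ []
reciprocals a (suc n) =
  - sum (λ k → a (suc (toℕ k)) * lookup (reciprocals a n) k) ∷ reciprocals a n

reciprocal : Series → Series
reciprocal a n = head (reciprocals a n)

lookup-reciprocals : ∀ a n (k : Fin (suc n)) → lookup (reciprocals a n) k ≡ reciprocal a (n ∸ toℕ k)
lookup-reciprocals a zero    Fin.zero    = ≡.refl
lookup-reciprocals a (suc n) Fin.zero    = ≡.refl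
lookup-reciprocals a (suc n) (Fin.suc k) = lookup-reciprocals a n k

⊛-reciprocal : ∀ a → a 0 ≈ 1ℝ → a ⊛ reciprocal a ≋ one
⊛-reciprocal a a0 zero = begin
  a 0 * 1ℝ + 0ℝ ≈⟨ R.+-identityʳ _ ⟩
  a 0 * 1ℝ      ≈⟨ R.*-identityʳ _ ⟩
  a 0           ≈⟨ a0 ⟩
  1ℝ            ∎
  where open ≈-Reasoning R.setoid
⊛-reciprocal a a0 (suc n) = begin
  a 0 * (- Σ) + Σ′ ≈⟨ R.+-cong (R.trans (R.*-congʳ a0) (R.*-identityˡ _)) Σ′≈Σ ⟩
  - Σ + Σ          ≈⟨ R.-‿inverseˡ Σ ⟩
  0ℝ               ∎
  where
  open ≈-Reasoning R.setoid
  Σ Σ′ : ℝ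
  Σ  = sum (λ k → a (suc (toℕ k)) * lookup (reciprocals a n) k)
  Σ′ = sum (λ (k : Fin (suc n)) → a (suc (toℕ k)) * reciprocal a (n ∸ toℕ k))
  Σ′≈Σ : Σ′ ≈ Σ
  Σ′≈Σ = sum-cong-≋ (λ k → R.reflexive
    (cong (a (suc (toℕ k)) *_) (≡.sym (lookup-reciprocals a n k))))

-- e_λ^x(t)
degExp : ℝ → ℝ → Series
degExp ƛ x k = degFalling x k ƛ * 1/ k !

-- t / (e_λ(t) - 1), as the multiplicative inverse of (e_λ(t) - 1) / t,
-- a series with constant term 1.
t/[e-1] : ℝ → Series
t/[e-1] ƛ = reciprocal (divide-by-t (degExp ƛ 1ℝ ⊖ one))

[e-1]⊛t/[e-1] : ∀ ƛ → (degExp ƛ 1ℝ ⊖ one) ⊛ t/[e-1] ƛ ≋ t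
[e-1]⊛t/[e-1] ƛ = proof
  where
  open ≈-Reasoning R.setoid
  open RingProperties R.ring using (-0#≈0#)
  d : Series
  d = degExp ƛ 1ℝ ⊖ one
  d0 : d 0 ≈ 0ℝ
  d0 = R.trans (R.+-congʳ (R.*-identityˡ 1ℝ)) (R.-‿inverseʳ 1ℝ)
  d1 : d 1 ≈ 1ℝ
  d1 = begin
    1ℝ * (1ℝ - 0ℝ * ƛ) * 1ℝ - 0ℝ ≈⟨ R.+-congˡ -0#≈0# ⟩
    1ℝ * (1ℝ - 0ℝ * ƛ) * 1ℝ + 0ℝ ≈⟨ R.+-identityʳ _ ⟩
    1ℝ * (1ℝ - 0ℝ * ƛ) * 1ℝ      ≈⟨ R.*-identityʳ _ ⟩
    1ℝ * (1ℝ - 0ℝ * ƛ)           ≈⟨ R.*-identityˡ _ ⟩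
    1ℝ - 0ℝ * ƛ                  ≈⟨ R.+-congˡ (R.-‿cong (R.zeroˡ ƛ)) ⟩
    1ℝ - 0ℝ                      ≈⟨ R.+-congˡ -0#≈0# ⟩
    1ℝ + 0ℝ                      ≈⟨ R.+-identityʳ _ ⟩
    1ℝ                           ∎
  one≈t : ∀ n → one n ≈ t (suc n)
  one≈t zero    = R.refl
  one≈t (suc n) = R.refl
  proof : d ⊛ t/[e-1] ƛ ≋ t
  proof zero    = R.trans (R.+-identityʳ _) (R.trans (R.*-congʳ d0) (R.zeroˡ _))
  proof (suc n) = begin
    d 0 * t/[e-1] ƛ (suc n) + (divide-by-t d ⊛ t/[e-1] ƛ) n
      ≈⟨ R.+-cong (R.trans (R.*-congʳ d0) (R.zeroˡ _)) (⊛-reciprocal (divide-by-t d) d1 n) ⟩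
    0ℝ + one n ≈⟨ R.+-identityˡ _ ⟩
    one n      ≈⟨ one≈t n ⟩
    t (suc n)  ∎

-- β_{n,λ}(x) is n! times the coefficient of tⁿ in t / (e_λ(t) - 1) · e_λ^x(t).
β : ℕ → ℝ → ℝ → ℝ
β n ƛ x = fromℕ (n !) * (t/[e-1] ƛ ⊛ degExp ƛ x) n

------------------------------------------------------------------------
-- Degenerate Stirling numbers of the second kind: the coefficients S n k
-- in the expansion of (y)_{n,λ} in falling factorials, as an identity in y.

IsDegenerateStirling₂ : ℝ → (ℕ → ℕ → ℝ) → Set
IsDegenerateStirling₂ ƛ S = ∀ n y → degFalling y n ƛ ≈ ∑[ k ≤ n ] S n k * falling y k

stirling₂ : ℝ → ℕ → ℕ → ℝ
stirling₂ ƛ zero    zero    = 1ℝ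
stirling₂ ƛ zero    (suc k) = 0ℝ
stirling₂ ƛ (suc n) zero    = (fromℕ 0 - fromℕ n * ƛ) * stirling₂ ƛ n 0
stirling₂ ƛ (suc n) (suc k) = stirling₂ ƛ n k + (fromℕ (suc k) - fromℕ n * ƛ) * stirling₂ ƛ n (suc k)

stirling₂-vanishes : ∀ ƛ n k → n ℕ.< k → stirling₂ ƛ n k ≈ 0ℝ
stirling₂-vanishes ƛ zero    (suc k) _           = R.refl
stirling₂-vanishes ƛ (suc n) (suc k) (ℕ.s≤s n<k) = R.trans
  (R.+-cong (stirling₂-vanishes ƛ n k n<k)
            (R.trans (R.*-congˡ (stirling₂-vanishes ƛ n (suc k) (ℕ.m<n⇒m<1+n n<k))) (R.zeroʳ _)))
  (R.+-identityˡ 0ℝ)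

isDegenerateStirling₂ : ∀ ƛ → IsDegenerateStirling₂ ƛ (stirling₂ ƛ)
isDegenerateStirling₂ ƛ zero    y = R.sym (R.trans (R.+-identityʳ _) (R.*-identityˡ 1ℝ))
isDegenerateStirling₂ ƛ (suc n) y = begin
  degFalling y n ƛ * (y - nƛ)
    ≈⟨ R.*-congʳ (isDegenerateStirling₂ ƛ n y) ⟩
  (∑[ k ≤ n ] s k * f k) * (y - nƛ)
    ≈⟨ *-distribʳ-sum {suc n} (y - nƛ) (λ k → s (toℕ k) * f (toℕ k)) ⟩
  ∑[ k ≤ n ] s k * f k * (y - nƛ)
    ≈⟨ sum-cong-≋ {suc n} (λ k → step (toℕ k)) ⟩
  ∑[ k ≤ n ] A k + C k
    ≈⟨ ∑-distrib-+ {suc n} (A ∘ toℕ) (C ∘ toℕ) ⟩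
  ∑-syntax n A + ∑-syntax n C
    ≈⟨ R.+-congˡ (R.sym extend) ⟩
  ∑-syntax n A + ∑-syntax (suc n) C
    ≈⟨ x∙yz≈y∙xz (∑-syntax n A) (C 0) (∑-syntax n (C ∘ suc)) ⟩
  C 0 + (∑-syntax n A + ∑-syntax n (C ∘ suc))
    ≈⟨ R.+-congˡ (R.sym (∑-distrib-+ {suc n} (A ∘ toℕ) (C ∘ suc ∘ toℕ))) ⟩
  C 0 + (∑[ k ≤ n ] A k + C (suc k))
    ≈⟨ R.+-congˡ (sum-cong-≋ {suc n} (λ k → R.sym (merge (toℕ k)))) ⟩
  ∑[ k ≤ suc n ] stirling₂ ƛ (suc n) k * falling y k ∎
  where
  open ≈-Reasoning R.setoid
  open CommutativeSemigroupProperties R.+-commutativeSemigroup using (x∙yz≈y∙xz)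
  nƛ : ℝ
  nƛ = fromℕ n * ƛ
  s f A C : ℕ → ℝ
  s = stirling₂ ƛ n
  f = falling y
  A k = s k * f (suc k)
  C k = (fromℕ k - nƛ) * s k * f k
  shift : ∀ k → y - nƛ ≈ (y - fromℕ k) + (fromℕ k - nƛ)
  shift k = R.sym (begin
    (y - fromℕ k) + (fromℕ k - nƛ)   ≈⟨ R.+-assoc y (- fromℕ k) (fromℕ k - nƛ) ⟩
    y + (- fromℕ k + (fromℕ k - nƛ)) ≈⟨ R.+-congˡ (R.sym (R.+-assoc (- fromℕ k) (fromℕ k) (- nƛ))) ⟩
    y + (- fromℕ k + fromℕ k - nƛ)   ≈⟨ R.+-congˡ (R.+-congʳ (R.-‿inverseˡ (fromℕ k))) ⟩
    y + (0ℝ - nƛ)                    ≈⟨ R.+-congˡ (R.+-identityˡ (- nƛ)) ⟩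
    y - nƛ                           ∎)
  step : ∀ k → s k * f k * (y - nƛ) ≈ A k + C k
  step k = begin
    s k * f k * (y - nƛ)                                        ≈⟨ R.*-congˡ (shift k) ⟩
    s k * f k * ((y - fromℕ k) + (fromℕ k - nƛ))                ≈⟨ R.distribˡ _ _ _ ⟩
    s k * f k * (y - fromℕ k) + s k * f k * (fromℕ k - nƛ)
      ≈⟨ R.+-cong (R.*-assoc (s k) (f k) (y - fromℕ k))
                  (R.trans (R.*-comm (s k * f k) (fromℕ k - nƛ))
                           (R.sym (R.*-assoc (fromℕ k - nƛ) (s k) (f k)))) ⟩
    A k + C k ∎
  merge : ∀ k → stirling₂ ƛ (suc n) (suc k) * f (suc k) ≈ A k + C (suc k)
  merge k = R.distribʳ (f (suc k)) (s k) ((fromℕ (suc k) - nƛ) * s (suc k))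
  extend : ∑-syntax (suc n) C ≈ ∑-syntax n C
  extend = begin
    ∑-syntax (suc n) C ≈⟨ sum-init-last {suc n} (C ∘ toℕ) ⟩
    sum {suc n} (λ k → C (toℕ (Fin.inject₁ k))) + C (toℕ (Fin.fromℕ (suc n)))
      ≈⟨ R.+-cong (sum-cong-≋ {suc n} (λ k → R.reflexive (cong C (toℕ-inject₁ k))))
                  (R.reflexive (cong C (toℕ-fromℕ (suc n)))) ⟩
    ∑-syntax n C + C (suc n)
      ≈⟨ R.+-congˡ (R.trans (R.*-congʳ (R.trans
           (R.*-congˡ (stirling₂-vanishes ƛ n (suc n) (ℕ.n<1+n n))) (R.zeroʳ _))) (R.zeroˡ _)) ⟩
    ∑-syntax n C + 0ℝ ≈⟨ R.+-identityʳ _ ⟩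
    ∑-syntax n C ∎

{-# OPTIONS --safe #-}

-- Put u = e_λ(t) - 1.  Then e_λ^y(t) = (1 + u)^y, the Stirling numbers
-- satisfy u^k / k! = ∑ S(n,k) t^n / n!, and t = ((1 + u)^λ - 1) / λ.  Hence
-- the generating function t / u · (1 + u)^x is a power series in u, whose
-- expansion in t is the claim.  Composition of series is avoided by an
-- umbral argument: let L be the linear functional sending (y)_k to k! times
-- the k-th coefficient of t / u · (1 + u)^x in u, so that the right-hand side
-- is L applied to (y)_{n,λ}.  Vandermonde's identity gives
-- L (p(y + 1) - p(y)) = (p(x + λ) - p(x)) / λ, and taking p = (y)_{n,λ} shows
-- that u · L(e_λ^y(t)) = t · e_λ^x(t).

module Submission where

open import Algebra.Bundles using (CommutativeRing)
import Algebra.Properties.Ring as RingProperties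
import Algebra.Properties.Semiring.Sum as SemiringSum
import Algebra.Solver.Ring as RingSolver
open import Algebra.Solver.Ring.AlmostCommutativeRing using (fromCommutativeRing; _-Raw-AlmostCommutative⟶_)
open import Data.Fin.Base using (toℕ)
import Data.Fin.Properties as Fin
import Data.Integer.Base as ℤ
import Data.Integer.Properties as ℤ
import Data.Maybe.Base as Maybe
open import Data.Nat.Base as ℕ using (ℕ; zero; suc; _∸_; _!; _≤_; z≤n; s≤s)
import Data.Nat.Properties as ℕ
open import Data.Product.Base using (_×_; _,_)
open import Data.Rational.Base as ℚ using (0ℚ; 1ℚ)
import Data.Rational.Properties as ℚ
import Data.Rational.Unnormalised.Base as ℚᵘ
import Data.Rational.Unnormalised.Properties as ℚᵘ
open import Defs
open import Function.Base using (_∘_)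
open import Relation.Binary.Consequences using (dec⇒weaklyDec)
open import Relation.Binary.PropositionalEquality as ≡ using (_≡_; cong)
import Relation.Binary.Reasoning.Setoid as ≈-Reasoning

private module R = CommutativeRing ℝ-commutativeRing

open RingProperties R.ring using (+-cancelˡ; +-inverseˡ-unique)
open SemiringSum R.semiring using (sum-cong-≋; ∑-distrib-+; ∑-comm; *-distribˡ-sum; *-distribʳ-sum; sum-init-last)
open ≈-Reasoning R.setoid

-- The embeddings of ℚ and ℕ into ℝ, and factorials.

fromℚ-neg : ∀ q → fromℚ (ℚ.- q) ≈ - fromℚ q
fromℚ-neg q = +-inverseˡ-unique (fromℚ (ℚ.- q)) (fromℚ q)
  (R.trans (R.sym (fromℚ-+ (ℚ.- q) q)) (R.reflexive (cong fromℚ (ℚ.+-inverseˡ q))))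

-- The operations of ℝ are opaque, so closed terms of ℝ do not compute; the
-- solver therefore takes its coefficients in ℚ.
fromℚ-morphism : ℚ.+-*-rawRing -Raw-AlmostCommutative⟶ fromCommutativeRing ℝ-commutativeRing
fromℚ-morphism = record
  { ⟦_⟧    = fromℚ
  ; +-homo = fromℚ-+
  ; *-homo = fromℚ-*
  ; -‿homo = fromℚ-neg
  ; 0-homo = R.refl
  ; 1-homo = R.refl
  }

open RingSolver ℚ.+-*-rawRing (fromCommutativeRing ℝ-commutativeRing) fromℚ-morphism
  (λ p q → Maybe.map (λ p≡q → R.reflexive (cong fromℚ p≡q)) (dec⇒weaklyDec ℚ._≟_ p q))
  using (solve; con; _:+_; _:*_; _:-_; _:=_)

-- Follows from injectivity of `toℚᵘ`. Since `n / 1` is by definition `fromℚᵘ` of an unnormalised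
-- fraction, the laws of `fromℕ` thereby reduce to integer identities.
fromℚᵘ-homo-+ : ∀ p q → ℚ.fromℚᵘ (p ℚᵘ.+ q) ≡ ℚ.fromℚᵘ p ℚ.+ ℚ.fromℚᵘ q
fromℚᵘ-homo-+ p q = ℚ.toℚᵘ-injective (ℚᵘ.≃-trans (ℚ.toℚᵘ-fromℚᵘ (p ℚᵘ.+ q))
  (ℚᵘ.≃-sym (ℚᵘ.≃-trans (ℚ.toℚᵘ-homo-+ (ℚ.fromℚᵘ p) (ℚ.fromℚᵘ q))
    (ℚᵘ.+-cong (ℚ.toℚᵘ-fromℚᵘ p) (ℚ.toℚᵘ-fromℚᵘ q)))))

fromℚᵘ-homo-* : ∀ p q → ℚ.fromℚᵘ (p ℚᵘ.* q) ≡ ℚ.fromℚᵘ p ℚ.* ℚ.fromℚᵘ q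
fromℚᵘ-homo-* p q = ℚ.toℚᵘ-injective (ℚᵘ.≃-trans (ℚ.toℚᵘ-fromℚᵘ (p ℚᵘ.* q))
  (ℚᵘ.≃-sym (ℚᵘ.≃-trans (ℚ.toℚᵘ-homo-* (ℚ.fromℚᵘ p) (ℚ.fromℚᵘ q))
    (ℚᵘ.*-cong (ℚ.toℚᵘ-fromℚᵘ p) (ℚ.toℚᵘ-fromℚᵘ q)))))

fromℕ-homo-+ : ∀ m n → fromℕ (m ℕ.+ n) ≈ fromℕ m + fromℕ n
fromℕ-homo-+ m n = begin
  fromℕ (m ℕ.+ n)
    ≡⟨ cong fromℚ (ℚ.fromℚᵘ-cong {ℚᵘ.mkℚᵘ (ℤ.+ (m ℕ.+ n)) 0} {ℚᵘ.mkℚᵘ (ℤ.+ m) 0 ℚᵘ.+ ℚᵘ.mkℚᵘ (ℤ.+ n) 0}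
         (ℚᵘ.*≡* (cong (ℤ._* ℤ.+ 1) (≡.sym (≡.cong₂ ℤ._+_ (ℤ.*-identityʳ (ℤ.+ m)) (ℤ.*-identityʳ (ℤ.+ n))))))) ⟩
  fromℚ (ℚ.fromℚᵘ (ℚᵘ.mkℚᵘ (ℤ.+ m) 0 ℚᵘ.+ ℚᵘ.mkℚᵘ (ℤ.+ n) 0))
    ≡⟨ cong fromℚ (fromℚᵘ-homo-+ (ℚᵘ.mkℚᵘ (ℤ.+ m) 0) (ℚᵘ.mkℚᵘ (ℤ.+ n) 0)) ⟩
  fromℚ ((ℤ.+ m ℚ./ 1) ℚ.+ (ℤ.+ n ℚ./ 1))
    ≈⟨ fromℚ-+ (ℤ.+ m ℚ./ 1) (ℤ.+ n ℚ./ 1) ⟩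
  fromℕ m + fromℕ n ∎

fromℕ-homo-* : ∀ m n → fromℕ (m ℕ.* n) ≈ fromℕ m * fromℕ n
fromℕ-homo-* m n = begin
  fromℕ (m ℕ.* n)
    ≡⟨ cong fromℚ (ℚ.fromℚᵘ-cong {ℚᵘ.mkℚᵘ (ℤ.+ (m ℕ.* n)) 0} {ℚᵘ.mkℚᵘ (ℤ.+ m) 0 ℚᵘ.* ℚᵘ.mkℚᵘ (ℤ.+ n) 0}
         (ℚᵘ.*≡* (cong (ℤ._* ℤ.+ 1) (ℤ.pos-* m n)))) ⟩
  fromℚ (ℚ.fromℚᵘ (ℚᵘ.mkℚᵘ (ℤ.+ m) 0 ℚᵘ.* ℚᵘ.mkℚᵘ (ℤ.+ n) 0))
    ≡⟨ cong fromℚ (fromℚᵘ-homo-* (ℚᵘ.mkℚᵘ (ℤ.+ m) 0) (ℚᵘ.mkℚᵘ (ℤ.+ n) 0)) ⟩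
  fromℚ ((ℤ.+ m ℚ./ 1) ℚ.* (ℤ.+ n ℚ./ 1))
    ≈⟨ fromℚ-* (ℤ.+ m ℚ./ 1) (ℤ.+ n ℚ./ 1) ⟩
  fromℕ m * fromℕ n ∎

fromℕ-split : ∀ {k n} → k ≤ n → fromℕ n ≈ fromℕ k + fromℕ (n ∸ k)
fromℕ-split {k} {n} k≤n =
  R.trans (R.reflexive (cong fromℕ (≡.sym (ℕ.m+[n∸m]≡n k≤n)))) (fromℕ-homo-+ k (n ∸ k))

fromℕ-suc : ∀ n → fromℕ (suc n) ≈ 1ℝ + fromℕ n
fromℕ-suc = fromℕ-homo-+ 1

n/1*1/n≡1 : ∀ n .{{_ : ℕ.NonZero n}} → (ℤ.+ n ℚ./ 1) ℚ.* (ℤ.+ 1 ℚ./ n) ≡ 1ℚ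
n/1*1/n≡1 n@(suc m) = ≡.trans
  (≡.sym (fromℚᵘ-homo-* (ℚᵘ.mkℚᵘ (ℤ.+ n) 0) (ℚᵘ.mkℚᵘ (ℤ.+ 1) m)))
  (ℚ.fromℚᵘ-cong {ℚᵘ.mkℚᵘ (ℤ.+ n) 0 ℚᵘ.* ℚᵘ.mkℚᵘ (ℤ.+ 1) m} {ℚᵘ.1ℚᵘ}
    (ℚᵘ.*≡* (≡.trans (ℤ.*-identityʳ (ℤ.+ n ℤ.* ℤ.+ 1)) (≡.trans (ℤ.*-comm (ℤ.+ n) (ℤ.+ 1))
      (cong (λ k → ℤ.+ 1 ℤ.* ℤ.+ suc k) (≡.sym (ℕ.+-identityʳ m)))))))

n!*1/n!≈1 : ∀ n → fromℕ (n !) * 1/ n ! ≈ 1ℝ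
n!*1/n!≈1 n = R.trans (R.sym (fromℚ-* _ _)) (R.reflexive (cong fromℚ (n/1*1/n≡1 (n !) {{n ℕ.!≢0}})))

[1+n]!≈[1+n]*n! : ∀ n → fromℕ (suc n !) ≈ fromℕ (suc n) * fromℕ (n !)
[1+n]!≈[1+n]*n! n = fromℕ-homo-* (suc n) (n !)

[1+n]*1/[1+n]!≈1/n! : ∀ n → fromℕ (suc n) * 1/ suc n ! ≈ 1/ n !
[1+n]*1/[1+n]!≈1/n! n = begin
  fromℕ (suc n) * 1/ suc n !
    ≈⟨ R.*-identityʳ _ ⟨
  fromℕ (suc n) * 1/ suc n ! * 1ℝ
    ≈⟨ R.*-congˡ (n!*1/n!≈1 n) ⟨
  fromℕ (suc n) * 1/ suc n ! * (fromℕ (n !) * 1/ n !)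
    ≈⟨ regroup (fromℕ (suc n)) (1/ suc n !) (fromℕ (n !)) (1/ n !) ⟩
  fromℕ (suc n) * fromℕ (n !) * 1/ suc n ! * 1/ n !
    ≈⟨ R.*-congʳ (R.trans (R.*-congʳ (R.sym ([1+n]!≈[1+n]*n! n))) (n!*1/n!≈1 (suc n))) ⟩
  1ℝ * 1/ n !
    ≈⟨ R.*-identityˡ _ ⟩
  1/ n ! ∎
  where
  regroup : ∀ a b c d → a * b * (c * d) ≈ a * c * b * d
  regroup = solve 4 (λ a b c d → a :* b :* (c :* d) := a :* c :* b :* d) R.refl

-- Taking the inverse as an argument lets the same cancellation serve for `fromℕ (suc n)` and for
-- `ƛ`.
*-cancelˡ-invertible : ∀ a a⁻¹ → a * a⁻¹ ≈ 1ℝ → ∀ {x y} → a * x ≈ a * y → x ≈ y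
*-cancelˡ-invertible a a⁻¹ aa⁻¹≈1 {x} {y} ax≈ay = R.trans (undo x) (R.trans (R.*-congˡ ax≈ay) (R.sym (undo y)))
  where
  undo : ∀ z → z ≈ a⁻¹ * (a * z)
  undo z = begin
    z              ≈⟨ R.*-identityˡ z ⟨
    1ℝ * z         ≈⟨ R.*-congʳ (R.trans (R.*-comm a⁻¹ a) aa⁻¹≈1) ⟨
    a⁻¹ * a * z    ≈⟨ R.*-assoc a⁻¹ a z ⟩
    a⁻¹ * (a * z)  ∎

*-cancelˡ-suc : ∀ n {x y} → fromℕ (suc n) * x ≈ fromℕ (suc n) * y → x ≈ y
*-cancelˡ-suc n = *-cancelˡ-invertible (fromℕ (suc n)) (fromℕ (n !) * 1/ suc n !) (begin
  fromℕ (suc n) * (fromℕ (n !) * 1/ suc n !) ≈⟨ R.*-assoc _ _ _ ⟨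
  fromℕ (suc n) * fromℕ (n !) * 1/ suc n !   ≈⟨ R.*-congʳ ([1+n]!≈[1+n]*n! n) ⟨
  fromℕ (suc n !) * 1/ suc n !               ≈⟨ n!*1/n!≈1 (suc n) ⟩
  1ℝ                                         ∎)

-- Finite sums.

∑-cong-≤ : ∀ n {f g : ℕ → ℝ} → (∀ k → k ≤ n → f k ≈ g k) → ∑-syntax n f ≈ ∑-syntax n g
∑-cong-≤ n f≈g = sum-cong-≋ {suc n} (λ k → f≈g (toℕ k) (Fin.toℕ≤pred[n] k))

∑-cong : ∀ n {f g : ℕ → ℝ} → (∀ k → f k ≈ g k) → ∑-syntax n f ≈ ∑-syntax n g
∑-cong n f≈g = ∑-cong-≤ n (λ k _ → f≈g k)

∑-+ : ∀ n (f g : ℕ → ℝ) → ∑[ k ≤ n ] (f k + g k) ≈ ∑-syntax n f + ∑-syntax n g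
∑-+ n f g = ∑-distrib-+ {suc n} (f ∘ toℕ) (g ∘ toℕ)

*-∑ : ∀ n a (f : ℕ → ℝ) → a * ∑-syntax n f ≈ ∑[ k ≤ n ] a * f k
*-∑ n a f = *-distribˡ-sum {suc n} a (f ∘ toℕ)

∑-* : ∀ n a (f : ℕ → ℝ) → ∑-syntax n f * a ≈ ∑[ k ≤ n ] f k * a
∑-* n a f = *-distribʳ-sum {suc n} a (f ∘ toℕ)

∑-swap : ∀ m n (f : ℕ → ℕ → ℝ) → ∑[ i ≤ m ] ∑[ j ≤ n ] f i j ≈ ∑[ j ≤ n ] ∑[ i ≤ m ] f i j
∑-swap m n f = ∑-comm {suc m} {suc n} (λ i j → f (toℕ i) (toℕ j))

∑-last : ∀ n (f : ℕ → ℝ) → ∑-syntax (suc n) f ≈ ∑-syntax n f + f (suc n)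
∑-last n f = R.trans (sum-init-last {suc n} (f ∘ toℕ))
  (R.+-cong (sum-cong-≋ {suc n} (λ k → R.reflexive (cong f (Fin.toℕ-inject₁ k))))
            (R.reflexive (cong f (Fin.toℕ-fromℕ (suc n)))))

∑-zero : ∀ n (f : ℕ → ℝ) → (∀ k → f k ≈ 0ℝ) → ∑-syntax n f ≈ 0ℝ
∑-zero zero    f f≈0 = R.trans (R.+-identityʳ _) (f≈0 0)
∑-zero (suc n) f f≈0 = R.trans (R.+-cong (f≈0 0) (∑-zero n (f ∘ suc) (f≈0 ∘ suc))) (R.+-identityʳ _)

∑-head : ∀ n (f : ℕ → ℝ) → (∀ k → f (suc k) ≈ 0ℝ) → ∑-syntax n f ≈ f 0
∑-head zero    f f≈0 = R.+-identityʳ _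
∑-head (suc n) f f≈0 = R.trans (R.+-congˡ (∑-zero n (f ∘ suc) f≈0)) (R.+-identityʳ _)

∑-extend : ∀ {m n} (f : ℕ → ℝ) → (∀ k → m ℕ.< k → f k ≈ 0ℝ) → m ≤ n → ∑-syntax m f ≈ ∑-syntax n f
∑-extend {zero}  {n}     f f≈0 _         = R.trans (R.+-identityʳ _) (R.sym (∑-head n f (λ k → f≈0 (suc k) (s≤s z≤n))))
∑-extend {suc m} {suc n} f f≈0 (s≤s m≤n) = R.+-congˡ (∑-extend (f ∘ suc) (λ k m<k → f≈0 (suc k) (s≤s m<k)) m≤n)

-- Cauchy products of series.

⊛-congˡ : ∀ a {b b′} → b ≋ b′ → a ⊛ b ≋ a ⊛ b′
⊛-congˡ a b≋b′ n = ∑-cong n (λ k → R.*-congˡ {a k} (b≋b′ (n ∸ k)))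

⊛-congʳ : ∀ b {a a′} → a ≋ a′ → a ⊛ b ≋ a′ ⊛ b
⊛-congʳ b a≋a′ n = ∑-cong n (λ k → R.*-congʳ {b (n ∸ k)} (a≋a′ k))

-- Induction on the index, for all `a` at once: the tail of `a ⊛ b` is `a 0` times the tail of `b`
-- plus `a′ ⊛ b`. This avoids reindexing a triangular double sum.
⊛-assoc : ∀ a b c → (a ⊛ b) ⊛ c ≋ a ⊛ (b ⊛ c)
⊛-assoc a b c zero = begin
  (a 0 * b 0 + 0ℝ) * c 0 + 0ℝ   ≈⟨ R.+-congʳ (R.*-congʳ (R.+-identityʳ _)) ⟩
  (a 0 * b 0) * c 0 + 0ℝ        ≈⟨ R.+-congʳ (R.*-assoc _ _ _) ⟩
  a 0 * (b 0 * c 0) + 0ℝ        ≈⟨ R.+-congʳ (R.*-congˡ (R.+-identityʳ _)) ⟨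
  a 0 * (b 0 * c 0 + 0ℝ) + 0ℝ   ∎
⊛-assoc a b c (suc n) = begin
  (a 0 * b 0 + 0ℝ) * c (suc n) + (∑[ k ≤ n ] (a 0 * b (suc k) + (a′ ⊛ b) k) * c (n ∸ k))
    ≈⟨ R.+-cong (R.*-congʳ (R.+-identityʳ _)) (∑-cong n (λ k → R.distribʳ (c (n ∸ k)) (a 0 * b (suc k)) ((a′ ⊛ b) k))) ⟩
  a 0 * b 0 * c (suc n) + (∑[ k ≤ n ] (a 0 * b (suc k) * c (n ∸ k) + (a′ ⊛ b) k * c (n ∸ k)))
    ≈⟨ R.+-congˡ (∑-+ n (λ k → a 0 * b (suc k) * c (n ∸ k)) (λ k → (a′ ⊛ b) k * c (n ∸ k))) ⟩
  a 0 * b 0 * c (suc n) + ((∑[ k ≤ n ] a 0 * b (suc k) * c (n ∸ k)) + ((a′ ⊛ b) ⊛ c) n)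
    ≈⟨ R.+-congˡ (R.+-cong
         (R.trans (∑-cong n (λ k → R.*-assoc (a 0) (b (suc k)) (c (n ∸ k))))
                  (R.sym (*-∑ n (a 0) (λ k → b (suc k) * c (n ∸ k)))))
         (⊛-assoc a′ b c n)) ⟩
  a 0 * b 0 * c (suc n) + (a 0 * ((b ∘ suc) ⊛ c) n + (a′ ⊛ (b ⊛ c)) n)
    ≈⟨ regroup (a 0) (b 0) (c (suc n)) (((b ∘ suc) ⊛ c) n) ((a′ ⊛ (b ⊛ c)) n) ⟩
  a 0 * (b 0 * c (suc n) + ((b ∘ suc) ⊛ c) n) + (a′ ⊛ (b ⊛ c)) n ∎
  where
  a′ : Series
  a′ = a ∘ suc
  regroup : ∀ a b c d e → a * b * c + (a * d + e) ≈ a * (b * c + d) + e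
  regroup = solve 5 (λ a b c d e → a :* b :* c :+ (a :* d :+ e) := a :* (b :* c :+ d) :+ e) R.refl

-- The product unfolds by itself at the `a 0` end of the sum; this peels off the opposite end, where
-- `b 0` stands.
⊛-sucʳ : ∀ a b n → (a ⊛ b) (suc n) ≈ (a ⊛ (b ∘ suc)) n + a (suc n) * b 0
⊛-sucʳ a b zero    = R.+-cong (R.sym (R.+-identityʳ _)) (R.+-identityʳ _)
⊛-sucʳ a b (suc n) = R.trans (R.+-congˡ (⊛-sucʳ (a ∘ suc) b n)) (R.sym (R.+-assoc _ _ _))

one-⊛ : ∀ a → one ⊛ a ≋ a
one-⊛ a n = R.trans (∑-head n (λ k → one k * a (n ∸ k)) (λ k → R.zeroˡ _)) (R.*-identityˡ _)

⊛-one : ∀ a → a ⊛ one ≋ a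
⊛-one a zero    = R.trans (R.+-identityʳ _) (R.*-identityʳ _)
⊛-one a (suc n) = begin
  (a ⊛ one) (suc n)                             ≈⟨ ⊛-sucʳ a one n ⟩
  (∑[ k ≤ n ] a k * 0ℝ) + a (suc n) * 1ℝ        ≈⟨ R.+-cong (∑-zero n (λ k → a k * 0ℝ) (λ k → R.zeroʳ (a k))) (R.*-identityʳ _) ⟩
  0ℝ + a (suc n)                                ≈⟨ R.+-identityˡ _ ⟩
  a (suc n)                                     ∎

-- A right inverse r of a that itself has a right inverse s is also a left
-- inverse, because a ≋ a ⊛ (r ⊛ s) ≋ s.
reciprocal-⊛ : ∀ a → a 0 ≈ 1ℝ → reciprocal a ⊛ a ≋ one
reciprocal-⊛ a a0≈1 n = R.trans (⊛-congˡ r a≋s n) (r⊛s≋1 n)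
  where
  r s : Series
  r = reciprocal a
  s = reciprocal r
  r⊛s≋1 : r ⊛ s ≋ one
  r⊛s≋1 = ⊛-reciprocal r R.refl
  a≋s : a ≋ s
  a≋s k = begin
    a k              ≈⟨ ⊛-one a k ⟨
    (a ⊛ one) k      ≈⟨ ⊛-congˡ a r⊛s≋1 k ⟨
    (a ⊛ (r ⊛ s)) k  ≈⟨ ⊛-assoc a r s k ⟨
    ((a ⊛ r) ⊛ s) k  ≈⟨ ⊛-congʳ s (⊛-reciprocal a a0≈1) k ⟩
    (one ⊛ s) k      ≈⟨ one-⊛ s k ⟩
    s k              ∎

-- The differential equation and addition law of degenerate exponentials.

θ : Series → Series
θ a n = fromℕ n * a n

-- `θ` is the Euler operator t d/dt, and `θ a ∘ suc` the ordinary derivative. The product rule holds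
-- termwise because n = k + (n - k).
θ-⊛ : ∀ a b → θ (a ⊛ b) ≋ λ n → (θ a ⊛ b) n + (a ⊛ θ b) n
θ-⊛ a b n = begin
  fromℕ n * (a ⊛ b) n
    ≈⟨ *-∑ n (fromℕ n) (λ k → a k * b (n ∸ k)) ⟩
  (∑[ k ≤ n ] fromℕ n * (a k * b (n ∸ k)))
    ≈⟨ ∑-cong-≤ n (λ k k≤n → R.trans (R.*-congʳ (fromℕ-split k≤n))
         (regroup (fromℕ k) (fromℕ (n ∸ k)) (a k) (b (n ∸ k)))) ⟩
  (∑[ k ≤ n ] (fromℕ k * a k * b (n ∸ k) + a k * (fromℕ (n ∸ k) * b (n ∸ k))))
    ≈⟨ ∑-+ n (λ k → θ a k * b (n ∸ k)) (λ k → a k * θ b (n ∸ k)) ⟩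
  (θ a ⊛ b) n + (a ⊛ θ b) n ∎
  where
  regroup : ∀ k l a b → (k + l) * (a * b) ≈ k * a * b + a * (l * b)
  regroup = solve 4 (λ k l a b → (k :+ l) :* (a :* b) := k :* a :* b :+ a :* (l :* b)) R.refl

⊛-leibniz : ∀ a b n → θ (a ⊛ b) (suc n) ≈ ((θ a ∘ suc) ⊛ b) n + (a ⊛ (θ b ∘ suc)) n
⊛-leibniz a b n = begin
  θ (a ⊛ b) (suc n)
    ≈⟨ θ-⊛ a b (suc n) ⟩
  (θ a ⊛ b) (suc n) + (a ⊛ θ b) (suc n)
    ≈⟨ R.+-congˡ (⊛-sucʳ a (θ b) n) ⟩
  0ℝ * a 0 * b (suc n) + ((θ a ∘ suc) ⊛ b) n + ((a ⊛ (θ b ∘ suc)) n + a (suc n) * (0ℝ * b 0))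
    -- The two end terms carry the factor 0 coming from `θ a 0` and `θ b 0`.
    ≈⟨ regroup (a 0) (b (suc n)) (((θ a ∘ suc) ⊛ b) n) ((a ⊛ (θ b ∘ suc)) n) (a (suc n)) (b 0) ⟩
  ((θ a ∘ suc) ⊛ b) n + (a ⊛ (θ b ∘ suc)) n ∎
  where
  regroup : ∀ a b c d e f → 0ℝ * a * b + c + (d + e * (0ℝ * f)) ≈ c + d
  regroup = solve 6 (λ a b c d e f → con 0ℚ :* a :* b :+ c :+ (d :+ e :* (con 0ℚ :* f)) := c :+ d) R.refl

-- The coefficient form of the differential equation (1 + μt) f′ = x f.
θ-degExp : ∀ μ x n → θ (degExp μ x) (suc n) ≈ (x - fromℕ n * μ) * degExp μ x n
θ-degExp μ x n = begin
  fromℕ (suc n) * (F * (x - fromℕ n * μ) * 1/ suc n !)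
    ≈⟨ regroup (fromℕ (suc n)) F (x - fromℕ n * μ) (1/ suc n !) ⟩
  (x - fromℕ n * μ) * (F * (fromℕ (suc n) * 1/ suc n !))
    ≈⟨ R.*-congˡ (R.*-congˡ ([1+n]*1/[1+n]!≈1/n! n)) ⟩
  (x - fromℕ n * μ) * (F * 1/ n !) ∎
  where
  F : ℝ
  F = degFalling x n μ
  regroup : ∀ a b c d → a * (b * c * d) ≈ c * (b * (a * d))
  regroup = solve 4 (λ a b c d → a :* (b :* c :* d) := c :* (b :* (a :* d))) R.refl

-- The recurrence determines each coefficient from the one before, as n + 1 is invertible.
degExp-unique : ∀ μ x f → f 0 ≈ 1ℝ → (∀ n → θ f (suc n) ≈ (x - fromℕ n * μ) * f n) → f ≋ degExp μ x
degExp-unique μ x f f0≈1 θf zero    = R.trans f0≈1 (R.sym (R.*-identityˡ 1ℝ))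
degExp-unique μ x f f0≈1 θf (suc n) = *-cancelˡ-suc n (begin
  θ f (suc n)                            ≈⟨ θf n ⟩
  (x - fromℕ n * μ) * f n                ≈⟨ R.*-congˡ (degExp-unique μ x f f0≈1 θf n) ⟩
  (x - fromℕ n * μ) * degExp μ x n       ≈⟨ θ-degExp μ x n ⟨
  θ (degExp μ x) (suc n)                 ∎)

-- By the product rule, the product has constant term 1 and solves the differential equation with
-- exponent x + y, so uniqueness applies.
degExp-+ : ∀ μ x y → degExp μ x ⊛ degExp μ y ≋ degExp μ (x + y)
degExp-+ μ x y = degExp-unique μ (x + y) (a ⊛ b) initial step
  where
  a b : Series
  a = degExp μ x
  b = degExp μ y
  initial : (a ⊛ b) 0 ≈ 1ℝ
  initial = solve 0 (con 1ℚ :* con 1ℚ :* (con 1ℚ :* con 1ℚ) :+ con 0ℚ := con 1ℚ) R.refl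
  regroup : ∀ x y μ k l a b →
    (x - k * μ) * a * b + a * ((y - l * μ) * b) ≈ (x + y - (k + l) * μ) * (a * b)
  regroup = solve 7 (λ x y μ k l a b →
    (x :- k :* μ) :* a :* b :+ a :* ((y :- l :* μ) :* b) := (x :+ y :- (k :+ l) :* μ) :* (a :* b)) R.refl
  term : ∀ n k → k ≤ n →
    θ a (suc k) * b (n ∸ k) + a k * θ b (suc (n ∸ k)) ≈ (x + y - fromℕ n * μ) * (a k * b (n ∸ k))
  term n k k≤n = begin
    θ a (suc k) * b (n ∸ k) + a k * θ b (suc (n ∸ k))
      ≈⟨ R.+-cong (R.*-congʳ (θ-degExp μ x k)) (R.*-congˡ (θ-degExp μ y (n ∸ k))) ⟩
    (x - fromℕ k * μ) * a k * b (n ∸ k) + a k * ((y - fromℕ (n ∸ k) * μ) * b (n ∸ k))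
      ≈⟨ regroup x y μ (fromℕ k) (fromℕ (n ∸ k)) (a k) (b (n ∸ k)) ⟩
    (x + y - (fromℕ k + fromℕ (n ∸ k)) * μ) * (a k * b (n ∸ k))
      ≈⟨ R.*-congʳ (R.+-congˡ (R.-‿cong (R.*-congʳ (fromℕ-split k≤n)))) ⟨
    (x + y - fromℕ n * μ) * (a k * b (n ∸ k)) ∎
  step : ∀ n → θ (a ⊛ b) (suc n) ≈ (x + y - fromℕ n * μ) * (a ⊛ b) n
  step n = begin
    θ (a ⊛ b) (suc n)
      ≈⟨ ⊛-leibniz a b n ⟩
    ((θ a ∘ suc) ⊛ b) n + (a ⊛ (θ b ∘ suc)) n
      ≈⟨ ∑-+ n (λ k → θ a (suc k) * b (n ∸ k)) (λ k → a k * θ b (suc (n ∸ k))) ⟨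
    (∑[ k ≤ n ] (θ a (suc k) * b (n ∸ k) + a k * θ b (suc (n ∸ k))))
      ≈⟨ ∑-cong-≤ n (term n) ⟩
    (∑[ k ≤ n ] (x + y - fromℕ n * μ) * (a k * b (n ∸ k)))
      ≈⟨ *-∑ n (x + y - fromℕ n * μ) (λ k → a k * b (n ∸ k)) ⟨
    (x + y - fromℕ n * μ) * (a ⊛ b) n ∎

-- Finite differences of falling factorials.

-- Raising the argument by one step μ shifts every factor by one place, so a new factor appears in
-- front, whereas the definition appends factors at the end.
degFalling-suc : ∀ x μ n → degFalling (x + μ) (suc n) μ ≈ (x + μ) * degFalling x n μ
degFalling-suc x μ zero    =
  solve 2 (λ x μ → con 1ℚ :* (x :+ μ :- con 0ℚ :* μ) := (x :+ μ) :* con 1ℚ) R.refl x μ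
degFalling-suc x μ (suc n) = begin
  degFalling (x + μ) (suc n) μ * (x + μ - fromℕ (suc n) * μ)
    ≈⟨ R.*-cong (degFalling-suc x μ n) (R.+-congˡ (R.-‿cong (R.*-congʳ (fromℕ-suc n)))) ⟩
  (x + μ) * degFalling x n μ * (x + μ - (1ℝ + fromℕ n) * μ)
    ≈⟨ solve 4 (λ x μ k F → (x :+ μ) :* F :* (x :+ μ :- (con 1ℚ :+ k) :* μ) := (x :+ μ) :* (F :* (x :- k :* μ)))
         R.refl x μ (fromℕ n) (degFalling x n μ) ⟩
  (x + μ) * (degFalling x n μ * (x - fromℕ n * μ)) ∎

-- Both products of length n + 1 contain `F`; their remaining factors x + μ and x - nμ differ by (n
-- + 1)μ.
degFalling-shift : ∀ x μ n →
  degFalling (x + μ) (suc n) μ ≈ degFalling x (suc n) μ + fromℕ (suc n) * μ * degFalling x n μ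
degFalling-shift x μ n = begin
  degFalling (x + μ) (suc n) μ
    ≈⟨ degFalling-suc x μ n ⟩
  (x + μ) * F
    ≈⟨ solve 4 (λ x μ k F → (x :+ μ) :* F := F :* (x :- k :* μ) :+ (con 1ℚ :+ k) :* μ :* F) R.refl x μ (fromℕ n) F ⟩
  F * (x - fromℕ n * μ) + (1ℝ + fromℕ n) * μ * F
    ≈⟨ R.+-congˡ (R.*-congʳ (R.*-congʳ (fromℕ-suc n))) ⟨
  F * (x - fromℕ n * μ) + fromℕ (suc n) * μ * F ∎
  where
  F : ℝ
  F = degFalling x n μ

-- The coefficients of e_μ^(x+μ)(t) = (1 + μt) e_μ^x(t).
degExp-shift : ∀ μ x n → degExp μ (x + μ) (suc n) ≈ degExp μ x (suc n) + μ * degExp μ x n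
degExp-shift μ x n = begin
  degFalling (x + μ) (suc n) μ * 1/ suc n !
    ≈⟨ R.*-congʳ (degFalling-shift x μ n) ⟩
  (degFalling x (suc n) μ + fromℕ (suc n) * μ * degFalling x n μ) * 1/ suc n !
    ≈⟨ solve 5 (λ G N μ F r → (G :+ N :* μ :* F) :* r := G :* r :+ μ :* (F :* (N :* r)))
         R.refl (degFalling x (suc n) μ) (fromℕ (suc n)) μ (degFalling x n μ) (1/ suc n !) ⟩
  degExp μ x (suc n) + μ * (degFalling x n μ * (fromℕ (suc n) * 1/ suc n !))
    ≈⟨ R.+-congˡ (R.*-congˡ (R.*-congˡ ([1+n]*1/[1+n]!≈1/n! n))) ⟩
  degExp μ x (suc n) + μ * degExp μ x n ∎

falling≈degFalling : ∀ x n → falling x n ≈ degFalling x n 1ℝ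
falling≈degFalling x zero    = R.refl
falling≈degFalling x (suc n) =
  R.*-cong (falling≈degFalling x n) (R.+-congˡ (R.-‿cong (R.sym (R.*-identityʳ (fromℕ n)))))

falling-shift : ∀ y n → falling (y + 1ℝ) (suc n) ≈ falling y (suc n) + fromℕ (suc n) * falling y n
falling-shift y n = begin
  falling (y + 1ℝ) (suc n)
    ≈⟨ falling≈degFalling (y + 1ℝ) (suc n) ⟩
  degFalling (y + 1ℝ) (suc n) 1ℝ
    ≈⟨ degFalling-shift y 1ℝ n ⟩
  degFalling y (suc n) 1ℝ + fromℕ (suc n) * 1ℝ * degFalling y n 1ℝ
    ≈⟨ R.+-cong (falling≈degFalling y (suc n))
         (R.*-cong (R.sym (R.*-identityʳ _)) (falling≈degFalling y n)) ⟨
  falling y (suc n) + fromℕ (suc n) * falling y n ∎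

falling-0 : ∀ n → falling 0ℝ (suc n) ≈ 0ℝ
falling-0 zero    = solve 0 (con 1ℚ :* (con 0ℚ :- con 0ℚ) := con 0ℚ) R.refl
falling-0 (suc n) = R.trans (R.*-congʳ (falling-0 n)) (R.zeroˡ _)

-- Vandermonde's identity, as the case μ = 1 of `degExp-+`.
binomial-+ : ∀ x y → binomial x ⊛ binomial y ≋ binomial (x + y)
binomial-+ x y n = begin
  (binomial x ⊛ binomial y) n       ≈⟨ ⊛-congʳ (binomial y) (binomial≋degExp x) n ⟩
  (degExp 1ℝ x ⊛ binomial y) n      ≈⟨ ⊛-congˡ (degExp 1ℝ x) (binomial≋degExp y) n ⟩
  (degExp 1ℝ x ⊛ degExp 1ℝ y) n     ≈⟨ degExp-+ 1ℝ x y n ⟩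
  degExp 1ℝ (x + y) n               ≈⟨ binomial≋degExp (x + y) n ⟨
  binomial (x + y) n                ∎
  where
  binomial≋degExp : ∀ x → binomial x ≋ degExp 1ℝ x
  binomial≋degExp x k = R.*-congʳ (falling≈degFalling x k)

-- On falling factorial coefficients the forward difference acts as the derivative does on power
-- coefficients: the new coefficients are `θ a ∘ suc`.
∑-falling-shift : ∀ n (a : ℕ → ℝ) y →
  ∑[ k ≤ suc n ] a k * falling (y + 1ℝ) k ≈
  (∑[ k ≤ suc n ] a k * falling y k) + (∑[ k ≤ n ] fromℕ (suc k) * a (suc k) * falling y k)
∑-falling-shift n a y = begin
  a 0 * 1ℝ + (∑[ k ≤ n ] a (suc k) * falling (y + 1ℝ) (suc k))
    ≈⟨ R.+-congˡ (∑-cong n term) ⟩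
  a 0 * 1ℝ + (∑[ k ≤ n ] (a (suc k) * falling y (suc k) + fromℕ (suc k) * a (suc k) * falling y k))
    ≈⟨ R.+-congˡ (∑-+ n (λ k → a (suc k) * falling y (suc k)) (λ k → fromℕ (suc k) * a (suc k) * falling y k)) ⟩
  a 0 * 1ℝ + ((∑[ k ≤ n ] a (suc k) * falling y (suc k)) + (∑[ k ≤ n ] fromℕ (suc k) * a (suc k) * falling y k))
    ≈⟨ R.+-assoc _ _ _ ⟨
  (∑[ k ≤ suc n ] a k * falling y k) + (∑[ k ≤ n ] fromℕ (suc k) * a (suc k) * falling y k) ∎
  where
  term : ∀ k → a (suc k) * falling (y + 1ℝ) (suc k) ≈
               a (suc k) * falling y (suc k) + fromℕ (suc k) * a (suc k) * falling y k
  term k = R.trans (R.*-congˡ (falling-shift y k))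
    (solve 4 (λ a G N F → a :* (G :+ N :* F) := a :* G :+ N :* a :* F) R.refl
      (a (suc k)) (falling y (suc k)) (fromℕ (suc k)) (falling y k))

-- Evaluating at 0 gives the constant coefficients; the others follow by
-- applying the difference operator, which needs no division by y.
falling-coefficients-unique : ∀ n (a b : ℕ → ℝ) →
  (∀ y → ∑[ k ≤ n ] a k * falling y k ≈ ∑[ k ≤ n ] b k * falling y k) →
  ∀ k → k ≤ n → a k ≈ b k
falling-coefficients-unique n a b eq zero _ = begin
  a 0                                ≈⟨ at-0 a ⟨
  (∑[ k ≤ n ] a k * falling 0ℝ k)    ≈⟨ eq 0ℝ ⟩
  (∑[ k ≤ n ] b k * falling 0ℝ k)    ≈⟨ at-0 b ⟩
  b 0                                ∎
  where
  at-0 : ∀ c → (∑[ k ≤ n ] c k * falling 0ℝ k) ≈ c 0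
  at-0 c = R.trans (∑-head n (λ k → c k * falling 0ℝ k) (λ k → R.trans (R.*-congˡ (falling-0 k)) (R.zeroʳ _)))
                   (R.*-identityʳ _)
falling-coefficients-unique (suc n) a b eq (suc k) (s≤s k≤n) =
  *-cancelˡ-suc k (falling-coefficients-unique n (θ a ∘ suc) (θ b ∘ suc) eq′ k k≤n)
  where
  eq′ : ∀ y → ∑[ k ≤ n ] θ a (suc k) * falling y k ≈ ∑[ k ≤ n ] θ b (suc k) * falling y k
  eq′ y = +-cancelˡ (∑[ k ≤ suc n ] a k * falling y k) _ _ (begin
    (∑[ k ≤ suc n ] a k * falling y k) + (∑[ k ≤ n ] θ a (suc k) * falling y k)
      ≈⟨ ∑-falling-shift n a y ⟨
    (∑[ k ≤ suc n ] a k * falling (y + 1ℝ) k)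
      ≈⟨ eq (y + 1ℝ) ⟩
    (∑[ k ≤ suc n ] b k * falling (y + 1ℝ) k)
      ≈⟨ ∑-falling-shift n b y ⟩
    (∑[ k ≤ suc n ] b k * falling y k) + (∑[ k ≤ n ] θ b (suc k) * falling y k)
      ≈⟨ R.+-congʳ (eq y) ⟨
    (∑[ k ≤ suc n ] a k * falling y k) + (∑[ k ≤ n ] θ b (suc k) * falling y k) ∎)

falling-cong : ∀ {x y} → x ≈ y → ∀ n → falling x n ≈ falling y n
falling-cong x≈y zero    = R.refl
falling-cong x≈y (suc n) = R.*-cong (falling-cong x≈y n) (R.+-congʳ x≈y)

-- Stirling generating functions as powers of u = e_λ(t) - 1.

stirlingSeries : ℝ → ℕ → Series
stirlingSeries ƛ k n = stirling₂ ƛ n k * 1/ n !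

-- If L is the linear functional with L((y)_k) = `v k`, this is L(e_λ^y(t)); equivalently, it is the
-- exponential generating function of `v` evaluated at u.
stirlingTransform : ℝ → (ℕ → ℝ) → Series
stirlingTransform ƛ v n = ∑[ k ≤ n ] stirlingSeries ƛ k n * v k

stirlingTransform-extend : ∀ ƛ v {m n} → m ≤ n →
  stirlingTransform ƛ v m ≈ ∑[ k ≤ n ] stirlingSeries ƛ k m * v k
stirlingTransform-extend ƛ v {m} = ∑-extend (λ k → stirlingSeries ƛ k m * v k) λ k m<k →
  R.trans (R.*-congʳ (R.trans (R.*-congʳ (stirling₂-vanishes ƛ m k m<k)) (R.zeroˡ _))) (R.zeroˡ _)

degExp≋stirlingTransform : ∀ ƛ y → degExp ƛ y ≋ stirlingTransform ƛ (falling y)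
degExp≋stirlingTransform ƛ y n = begin
  degFalling y n ƛ * 1/ n !
    ≈⟨ R.*-congʳ (isDegenerateStirling₂ ƛ n y) ⟩
  (∑[ k ≤ n ] stirling₂ ƛ n k * falling y k) * 1/ n !
    ≈⟨ ∑-* n (1/ n !) (λ k → stirling₂ ƛ n k * falling y k) ⟩
  (∑[ k ≤ n ] stirling₂ ƛ n k * falling y k * 1/ n !)
    ≈⟨ ∑-cong n (λ k → solve 3 (λ s f r → s :* f :* r := s :* r :* f) R.refl (stirling₂ ƛ n k) (falling y k) (1/ n !)) ⟩
  (∑[ k ≤ n ] stirlingSeries ƛ k n * falling y k) ∎

⊛-stirlingTransform : ∀ ƛ a v n →
  (a ⊛ stirlingTransform ƛ v) n ≈ ∑[ k ≤ n ] (a ⊛ stirlingSeries ƛ k) n * v k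
⊛-stirlingTransform ƛ a v n = begin
  (∑[ i ≤ n ] a i * stirlingTransform ƛ v (n ∸ i))
    ≈⟨ ∑-cong n expand ⟩
  (∑[ i ≤ n ] ∑[ k ≤ n ] a i * s k (n ∸ i) * v k)
    ≈⟨ ∑-swap n n (λ i k → a i * s k (n ∸ i) * v k) ⟩
  (∑[ k ≤ n ] ∑[ i ≤ n ] a i * s k (n ∸ i) * v k)
    ≈⟨ ∑-cong n (λ k → ∑-* n (v k) (λ i → a i * s k (n ∸ i))) ⟨
  (∑[ k ≤ n ] (a ⊛ s k) n * v k) ∎
  where
  s : ℕ → Series
  s = stirlingSeries ƛ
  expand : ∀ i → a i * stirlingTransform ƛ v (n ∸ i) ≈ ∑[ k ≤ n ] a i * s k (n ∸ i) * v k
  expand i = begin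
    a i * stirlingTransform ƛ v (n ∸ i)
      -- The bound n - i depends on i; raising it to n, over vanishing Stirling numbers, makes the
      -- two sums interchangeable.
      ≈⟨ R.*-congˡ (stirlingTransform-extend ƛ v (ℕ.m∸n≤m n i)) ⟩
    a i * (∑[ k ≤ n ] s k (n ∸ i) * v k)
      ≈⟨ *-∑ n (a i) (λ k → s k (n ∸ i) * v k) ⟩
    (∑[ k ≤ n ] a i * (s k (n ∸ i) * v k))
      ≈⟨ ∑-cong n (λ k → R.*-assoc (a i) (s k (n ∸ i)) (v k)) ⟨
    (∑[ k ≤ n ] a i * s k (n ∸ i) * v k) ∎

-- With u = e_λ(t) - 1 this reads u · u^k / k! = (k + 1) · u^(k+1) / (k + 1)!.
-- It is obtained by comparing falling factorial coefficients in
-- e_λ(t) · e_λ^y(t) = e_λ^(y+1)(t).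
degExp-⊛-stirlingSeries : ∀ ƛ n k → k ≤ n →
  (degExp ƛ 1ℝ ⊛ stirlingSeries ƛ k) n ≈ stirlingSeries ƛ k n + fromℕ (suc k) * stirlingSeries ƛ (suc k) n
degExp-⊛-stirlingSeries ƛ n = falling-coefficients-unique n
  (λ k → (degExp ƛ 1ℝ ⊛ s k) n) (λ k → s k n + fromℕ (suc k) * s (suc k) n) λ y → begin
    (∑[ k ≤ n ] (degExp ƛ 1ℝ ⊛ s k) n * falling y k)
      ≈⟨ ⊛-stirlingTransform ƛ (degExp ƛ 1ℝ) (falling y) n ⟨
    (degExp ƛ 1ℝ ⊛ stirlingTransform ƛ (falling y)) n
      ≈⟨ ⊛-congˡ (degExp ƛ 1ℝ) (degExp≋stirlingTransform ƛ y) n ⟨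
    (degExp ƛ 1ℝ ⊛ degExp ƛ y) n
      ≈⟨ degExp-+ ƛ 1ℝ y n ⟩
    degExp ƛ (1ℝ + y) n
      ≈⟨ degExp≋stirlingTransform ƛ (1ℝ + y) n ⟩
    stirlingTransform ƛ (falling (1ℝ + y)) n
      ≈⟨ stirlingTransform-extend ƛ (falling (1ℝ + y)) (ℕ.n≤1+n n) ⟩
    (∑[ k ≤ suc n ] s k n * falling (1ℝ + y) k)
      ≈⟨ ∑-cong (suc n) (λ k → R.*-congˡ {s k n} (falling-cong (R.+-comm 1ℝ y) k)) ⟩
    (∑[ k ≤ suc n ] s k n * falling (y + 1ℝ) k)
      ≈⟨ ∑-falling-shift n (λ k → s k n) y ⟩
    (∑[ k ≤ suc n ] s k n * falling y k) + (∑[ k ≤ n ] fromℕ (suc k) * s (suc k) n * falling y k)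
      ≈⟨ R.+-congʳ (stirlingTransform-extend ƛ (falling y) (ℕ.n≤1+n n)) ⟨
    (∑[ k ≤ n ] s k n * falling y k) + (∑[ k ≤ n ] fromℕ (suc k) * s (suc k) n * falling y k)
      ≈⟨ ∑-+ n (λ k → s k n * falling y k) (λ k → fromℕ (suc k) * s (suc k) n * falling y k) ⟨
    (∑[ k ≤ n ] (s k n * falling y k + fromℕ (suc k) * s (suc k) n * falling y k))
      ≈⟨ ∑-cong n (λ k → R.distribʳ (falling y k) (s k n) (fromℕ (suc k) * s (suc k) n)) ⟨
    (∑[ k ≤ n ] (s k n + fromℕ (suc k) * s (suc k) n) * falling y k) ∎
  where
  s : ℕ → Series
  s = stirlingSeries ƛ

-- The tail of e_λ(t) is u / t. Restoring the constant term 1 of e_λ(t) adds `A (suc n)` to both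
-- sides, and the formula for e_λ(t) · u^k / k! then applies to each column.
degExp-tail-⊛-stirlingTransform : ∀ ƛ v n →
  ((degExp ƛ 1ℝ ∘ suc) ⊛ stirlingTransform ƛ v) n ≈
  ∑[ k ≤ suc n ] fromℕ (suc k) * stirlingSeries ƛ (suc k) (suc n) * v k
degExp-tail-⊛-stirlingTransform ƛ v n = +-cancelˡ (A (suc n)) _ _ (begin
  A (suc n) + ((degExp ƛ 1ℝ ∘ suc) ⊛ A) n
    ≈⟨ R.+-congʳ (solve 1 (λ a → con 1ℚ :* con 1ℚ :* a := a) R.refl (A (suc n))) ⟨
  (degExp ƛ 1ℝ ⊛ A) (suc n)
    ≈⟨ ⊛-stirlingTransform ƛ (degExp ƛ 1ℝ) v (suc n) ⟩
  (∑[ k ≤ suc n ] (degExp ƛ 1ℝ ⊛ s k) (suc n) * v k)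
    ≈⟨ ∑-cong-≤ (suc n) (λ k k≤ → R.trans (R.*-congʳ {v k} (degExp-⊛-stirlingSeries ƛ (suc n) k k≤))
         (R.distribʳ (v k) (s k (suc n)) (fromℕ (suc k) * s (suc k) (suc n)))) ⟩
  (∑[ k ≤ suc n ] (s k (suc n) * v k + fromℕ (suc k) * s (suc k) (suc n) * v k))
    ≈⟨ ∑-+ (suc n) (λ k → s k (suc n) * v k) (λ k → fromℕ (suc k) * s (suc k) (suc n) * v k) ⟩
  A (suc n) + (∑[ k ≤ suc n ] fromℕ (suc k) * s (suc k) (suc n) * v k) ∎)
  where
  s : ℕ → Series
  s = stirlingSeries ƛ
  A : Series
  A = stirlingTransform ƛ v

-- The expansion of t in powers of u.

-- Each of the n factors 1 - k / x absorbs one factor x of the power and becomes x - k.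
^-*-degFalling : ∀ x x⁻¹ → x * x⁻¹ ≈ 1ℝ → ∀ n → x ^ n * degFalling 1ℝ n x⁻¹ ≈ falling x n
^-*-degFalling x x⁻¹ xx⁻¹≈1 zero    = R.*-identityˡ 1ℝ
^-*-degFalling x x⁻¹ xx⁻¹≈1 (suc n) = begin
  x * x ^ n * (F * (1ℝ - fromℕ n * x⁻¹))
    ≈⟨ solve 5 (λ x p F k y → x :* p :* (F :* (con 1ℚ :- k :* y)) := p :* F :* (x :- k :* (x :* y)))
         R.refl x (x ^ n) F (fromℕ n) x⁻¹ ⟩
  x ^ n * F * (x - fromℕ n * (x * x⁻¹))
    ≈⟨ R.*-cong (^-*-degFalling x x⁻¹ xx⁻¹≈1 n)
         (R.+-congˡ (R.-‿cong (R.trans (R.*-congˡ xx⁻¹≈1) (R.*-identityʳ (fromℕ n))))) ⟩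
  falling x n * (x - fromℕ n) ∎
  where
  F : ℝ
  F = degFalling 1ℝ n x⁻¹

-- The coefficients of ((1 + u)^λ - 1) / (λ u), that is, of t / u as a
-- series in u = e_λ(t) - 1.
t/u : ℝ → ℝ → Series
t/u ƛ ƛ⁻¹ m = ƛ ^ m * 1/ suc m ! * degFalling 1ℝ (suc m) ƛ⁻¹

-- The coefficient of u^(m+1) in λt = (1 + u)^λ - 1.
*-t/u : ∀ ƛ ƛ⁻¹ → ƛ * ƛ⁻¹ ≈ 1ℝ → ∀ m → ƛ * t/u ƛ ƛ⁻¹ m ≈ binomial ƛ (suc m)
*-t/u ƛ ƛ⁻¹ ƛƛ⁻¹≈1 m = begin
  ƛ * (ƛ ^ m * 1/ suc m ! * degFalling 1ℝ (suc m) ƛ⁻¹)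
    ≈⟨ solve 4 (λ x p r F → x :* (p :* r :* F) := x :* p :* F :* r) R.refl
         ƛ (ƛ ^ m) (1/ suc m !) (degFalling 1ℝ (suc m) ƛ⁻¹) ⟩
  ƛ ^ suc m * degFalling 1ℝ (suc m) ƛ⁻¹ * 1/ suc m !
    ≈⟨ R.*-congʳ (^-*-degFalling ƛ ƛ⁻¹ ƛƛ⁻¹≈1 (suc m)) ⟩
  binomial ƛ (suc m) ∎

-- The coefficient of u^(k+1) in (λt + 1)(1 + u)^x = (1 + u)^(x+λ).
binomial-⊛-t/u : ∀ ƛ ƛ⁻¹ → ƛ * ƛ⁻¹ ≈ 1ℝ → ∀ x k →
  ƛ * (binomial x ⊛ t/u ƛ ƛ⁻¹) k + binomial x (suc k) ≈ binomial (x + ƛ) (suc k)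
binomial-⊛-t/u ƛ ƛ⁻¹ ƛƛ⁻¹≈1 x k = begin
  ƛ * (binomial x ⊛ c) k + binomial x (suc k)
    ≈⟨ R.+-cong (*-∑ k ƛ (λ j → binomial x j * c (k ∸ j)))
         -- The factor `binomial ƛ 0`, equal to 1, turns the extra summand into the missing end term
         -- of the product with `binomial ƛ`.
         (solve 1 (λ b → b := b :* (con 1ℚ :* con 1ℚ)) R.refl (binomial x (suc k))) ⟩
  (∑[ j ≤ k ] ƛ * (binomial x j * c (k ∸ j))) + binomial x (suc k) * binomial ƛ 0
    ≈⟨ R.+-congʳ (∑-cong k term) ⟩
  (binomial x ⊛ (binomial ƛ ∘ suc)) k + binomial x (suc k) * binomial ƛ 0
    ≈⟨ ⊛-sucʳ (binomial x) (binomial ƛ) k ⟨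
  (binomial x ⊛ binomial ƛ) (suc k)
    ≈⟨ binomial-+ x ƛ (suc k) ⟩
  binomial (x + ƛ) (suc k) ∎
  where
  c : Series
  c = t/u ƛ ƛ⁻¹
  term : ∀ j → ƛ * (binomial x j * c (k ∸ j)) ≈ binomial x j * binomial ƛ (suc (k ∸ j))
  term j = R.trans
    (solve 3 (λ x b c → x :* (b :* c) := b :* (x :* c)) R.refl ƛ (binomial x j) (c (k ∸ j)))
    (R.*-congˡ (*-t/u ƛ ƛ⁻¹ ƛƛ⁻¹≈1 (k ∸ j)))

n!*binomial : ∀ z n → fromℕ (n !) * binomial z n ≈ falling z n
n!*binomial z n = begin
  fromℕ (n !) * (falling z n * 1/ n !)
    ≈⟨ solve 3 (λ N f r → N :* (f :* r) := N :* r :* f) R.refl (fromℕ (n !)) (falling z n) (1/ n !) ⟩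
  fromℕ (n !) * 1/ n ! * falling z n
    ≈⟨ R.*-congʳ (n!*1/n!≈1 n) ⟩
  1ℝ * falling z n
    ≈⟨ R.*-identityˡ _ ⟩
  falling z n ∎

-- The umbral functional and the generating function of `β`.

module _ (ƛ ƛ⁻¹ : ℝ) (ƛƛ⁻¹≈1 : ƛ * ƛ⁻¹ ≈ 1ℝ) (x : ℝ) where

  private
    s : ℕ → Series
    s = stirlingSeries ƛ

    -- `w` lists the coefficients of t / u · (1 + u)^x in powers of u, and `v k` is the value of the
    -- functional L at (y)_k.
    w v : ℕ → ℝ
    w = binomial x ⊛ t/u ƛ ƛ⁻¹
    v k = fromℕ (k !) * w k

  -- This is λ L(p(y + 1) - p(y)) + p(x) = p(x + λ) for p = (y)_(k+1), whose difference is (k +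
  -- 1)(y)_k. It is `binomial-⊛-t/u` multiplied by (k + 1)!.
  falling-difference : ∀ k → ƛ * (fromℕ (suc k) * v k) + falling x (suc k) ≈ falling (x + ƛ) (suc k)
  falling-difference k = begin
    ƛ * (fromℕ (suc k) * (fromℕ (k !) * w k)) + falling x (suc k)
      ≈⟨ R.+-cong
           (solve 4 (λ l a b w → l :* (a :* (b :* w)) := a :* b :* (l :* w)) R.refl ƛ (fromℕ (suc k)) (fromℕ (k !)) (w k))
           (R.sym (n!*binomial x (suc k))) ⟩
    fromℕ (suc k) * fromℕ (k !) * (ƛ * w k) + fromℕ (suc k !) * binomial x (suc k)
      ≈⟨ R.+-congʳ (R.*-congʳ ([1+n]!≈[1+n]*n! k)) ⟨
    fromℕ (suc k !) * (ƛ * w k) + fromℕ (suc k !) * binomial x (suc k)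
      ≈⟨ R.distribˡ _ _ _ ⟨
    fromℕ (suc k !) * (ƛ * w k + binomial x (suc k))
      ≈⟨ R.*-congˡ (binomial-⊛-t/u ƛ ƛ⁻¹ ƛƛ⁻¹≈1 x k) ⟩
    fromℕ (suc k !) * binomial (x + ƛ) (suc k)
      ≈⟨ n!*binomial (x + ƛ) (suc k) ⟩
    falling (x + ƛ) (suc k) ∎

  -- By linearity the difference identity passes to p = (y)_(n+1,λ) / (n + 1)!. There `degExp-shift`
  -- evaluates p(x + λ) - p(x) as λ times `degExp ƛ x n`, and λ cancels.
  stirlingTransform-difference : ∀ n → ∑[ k ≤ suc n ] fromℕ (suc k) * s (suc k) (suc n) * v k ≈ degExp ƛ x n
  stirlingTransform-difference n = *-cancelˡ-invertible ƛ ƛ⁻¹ ƛƛ⁻¹≈1 (+-cancelˡ (degExp ƛ x (suc n)) _ _ (begin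
    degExp ƛ x (suc n) + ƛ * T
      ≈⟨ R.+-cong (split x) (*-∑ (suc n) ƛ (λ k → fromℕ (suc k) * s (suc k) (suc n) * v k)) ⟩
    s 0 (suc n) * 1ℝ + (∑[ k ≤ suc n ] s (suc k) (suc n) * falling x (suc k))
      + (∑[ k ≤ suc n ] ƛ * (fromℕ (suc k) * s (suc k) (suc n) * v k))
      ≈⟨ R.+-assoc _ _ _ ⟩
    s 0 (suc n) * 1ℝ + ((∑[ k ≤ suc n ] s (suc k) (suc n) * falling x (suc k))
      + (∑[ k ≤ suc n ] ƛ * (fromℕ (suc k) * s (suc k) (suc n) * v k)))
      ≈⟨ R.+-congˡ (∑-+ (suc n) (λ k → s (suc k) (suc n) * falling x (suc k))
           (λ k → ƛ * (fromℕ (suc k) * s (suc k) (suc n) * v k))) ⟨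
    s 0 (suc n) * 1ℝ + (∑[ k ≤ suc n ]
      (s (suc k) (suc n) * falling x (suc k) + ƛ * (fromℕ (suc k) * s (suc k) (suc n) * v k)))
      ≈⟨ R.+-congˡ (∑-cong (suc n) term) ⟩
    s 0 (suc n) * 1ℝ + (∑[ k ≤ suc n ] s (suc k) (suc n) * falling (x + ƛ) (suc k))
      ≈⟨ split (x + ƛ) ⟨
    degExp ƛ (x + ƛ) (suc n)
      ≈⟨ degExp-shift ƛ x n ⟩
    degExp ƛ x (suc n) + ƛ * degExp ƛ x n ∎))
    where
    T : ℝ
    T = ∑[ k ≤ suc n ] fromℕ (suc k) * s (suc k) (suc n) * v k
    -- The term k = 0 does not depend on z, so it is shared by x and x + λ. The bound is first
    -- raised to n + 2, so that the remaining sum has the same range as `T`.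
    split : ∀ z → degExp ƛ z (suc n) ≈
                  s 0 (suc n) * 1ℝ + (∑[ k ≤ suc n ] s (suc k) (suc n) * falling z (suc k))
    split z = R.trans (degExp≋stirlingTransform ƛ z (suc n))
                      (stirlingTransform-extend ƛ (falling z) (ℕ.n≤1+n (suc n)))
    term : ∀ k → s (suc k) (suc n) * falling x (suc k) + ƛ * (fromℕ (suc k) * s (suc k) (suc n) * v k)
               ≈ s (suc k) (suc n) * falling (x + ƛ) (suc k)
    term k = R.trans
      (solve 5 (λ s f l a v → s :* f :+ l :* (a :* s :* v) := s :* (l :* (a :* v) :+ f)) R.refl
        (s (suc k) (suc n)) (falling x (suc k)) ƛ (fromℕ (suc k)) (v k))
      (R.*-congˡ (falling-difference k))

  -- The preceding results give (u / t) · A = e_λ^x(t); multiplying by the left inverse of `d` = u /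
  -- t isolates `A`.
  t/[e-1]-⊛-degExp : t/[e-1] ƛ ⊛ degExp ƛ x ≋ stirlingTransform ƛ v
  t/[e-1]-⊛-degExp n = begin
    (r ⊛ degExp ƛ x) n  ≈⟨ ⊛-congˡ r d⊛A≋e n ⟨
    (r ⊛ (d ⊛ A)) n     ≈⟨ ⊛-assoc r d A n ⟨
    ((r ⊛ d) ⊛ A) n     ≈⟨ ⊛-congʳ A (reciprocal-⊛ d d0≈1) n ⟩
    (one ⊛ A) n         ≈⟨ one-⊛ A n ⟩
    A n                 ∎
    where
    A d r : Series
    A = stirlingTransform ƛ v
    d = divide-by-t (degExp ƛ 1ℝ ⊖ one)
    r = reciprocal d
    d≋tail : d ≋ degExp ƛ 1ℝ ∘ suc
    d≋tail k = solve 1 (λ a → a :- con 0ℚ := a) R.refl (degExp ƛ 1ℝ (suc k))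
    d0≈1 : d 0 ≈ 1ℝ
    d0≈1 = solve 1 (λ l → con 1ℚ :* (con 1ℚ :- con 0ℚ :* l) :* con 1ℚ :- con 0ℚ := con 1ℚ) R.refl ƛ
    d⊛A≋e : d ⊛ A ≋ degExp ƛ x
    d⊛A≋e k = begin
      (d ⊛ A) k                                              ≈⟨ ⊛-congʳ A d≋tail k ⟩
      ((degExp ƛ 1ℝ ∘ suc) ⊛ A) k                            ≈⟨ degExp-tail-⊛-stirlingTransform ƛ v k ⟩
      (∑[ j ≤ suc k ] fromℕ (suc j) * s (suc j) (suc k) * v j) ≈⟨ stirlingTransform-difference k ⟩
      degExp ƛ x k                                           ∎

  β≈∑ : ∀ S → IsDegenerateStirling₂ ƛ S → ∀ n →
    β n ƛ x ≈ ∑[ k ≤ n ] fromℕ (k !) * S n k * (binomial x ⊛ t/u ƛ ƛ⁻¹) k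
  β≈∑ S isS n = begin
    fromℕ (n !) * (t/[e-1] ƛ ⊛ degExp ƛ x) n
      ≈⟨ R.*-congˡ (t/[e-1]-⊛-degExp n) ⟩
    fromℕ (n !) * stirlingTransform ƛ v n
      ≈⟨ *-∑ n (fromℕ (n !)) (λ k → s k n * v k) ⟩
    (∑[ k ≤ n ] fromℕ (n !) * (s k n * v k))
      ≈⟨ ∑-cong-≤ n term ⟩
    (∑[ k ≤ n ] fromℕ (k !) * S n k * w k) ∎
    where
    term : ∀ k → k ≤ n → fromℕ (n !) * (s k n * v k) ≈ fromℕ (k !) * S n k * w k
    term k k≤n = begin
      fromℕ (n !) * (stirling₂ ƛ n k * 1/ n ! * (fromℕ (k !) * w k))
        ≈⟨ solve 5 (λ N s r K w → N :* (s :* r :* (K :* w)) := N :* r :* (K :* s :* w)) R.refl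
             (fromℕ (n !)) (stirling₂ ƛ n k) (1/ n !) (fromℕ (k !)) (w k) ⟩
      fromℕ (n !) * 1/ n ! * (fromℕ (k !) * stirling₂ ƛ n k * w k)
        ≈⟨ R.trans (R.*-congʳ (n!*1/n!≈1 n)) (R.*-identityˡ _) ⟩
      fromℕ (k !) * stirling₂ ƛ n k * w k
        -- Any `S` with the defining expansion agrees with `stirling₂` for k ≤ n, since falling
        -- factorial coefficients are unique.
        ≈⟨ R.*-congʳ (R.*-congˡ (falling-coefficients-unique n (stirling₂ ƛ n) (S n)
             (λ y → R.trans (R.sym (isDegenerateStirling₂ ƛ n y)) (isS n y)) k k≤n)) ⟩
      fromℕ (k !) * S n k * w k ∎

-- The general formula and its value at x = 0.

-- The series (1 + u)^0 is 1, so at x = 0 the inner sum collapses to its term j = 0.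
binomial-0-⊛ : ∀ a → binomial 0ℝ ⊛ a ≋ a
binomial-0-⊛ a n = R.trans
  (∑-head n (λ k → binomial 0ℝ k * a (n ∸ k)) λ k →
    R.trans (R.*-congʳ (R.trans (R.*-congʳ (falling-0 k)) (R.zeroˡ _))) (R.zeroˡ _))
  (solve 1 (λ b → con 1ℚ :* con 1ℚ :* b := b) R.refl (a n))

theorem7 : (ƛ : ℝ) (ƛ#0 : ƛ # 0ℝ) (S : ℕ → ℕ → ℝ) → IsDegenerateStirling₂ ƛ S →
    (n : ℕ) →
    ((x : ℝ) →
    β n ƛ x ≈
    ∑[ k ≤ n ] fromℕ (k !) * S n k *
    (∑[ j ≤ k ] binomial x j * (ƛ ^ (k ∸ j) * 1/ suc (k ∸ j) !)
    * degFalling 1ℝ (suc (k ∸ j)) (inverse ƛ ƛ#0)))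
    ×
    β n ƛ 0ℝ ≈
    ∑[ k ≤ n ] fromℕ (k !) * S n k * (ƛ ^ k * 1/ suc k !)
    * degFalling 1ℝ (suc k) (inverse ƛ ƛ#0)
theorem7 ƛ ƛ#0 S isS n = general , special
  where
  ƛ⁻¹ : ℝ
  ƛ⁻¹ = inverse ƛ ƛ#0
  a : ℕ → ℝ
  a k = fromℕ (k !) * S n k
  expansion : ∀ x → β n ƛ x ≈ ∑[ k ≤ n ] a k * (binomial x ⊛ t/u ƛ ƛ⁻¹) k
  expansion x = β≈∑ ƛ ƛ⁻¹ (inverseʳ ƛ ƛ#0) x S isS n
  general : ∀ x → β n ƛ x ≈
    ∑[ k ≤ n ] a k * (∑[ j ≤ k ] binomial x j * (ƛ ^ (k ∸ j) * 1/ suc (k ∸ j) !) * degFalling 1ℝ (suc (k ∸ j)) ƛ⁻¹)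
  -- Unfolding `t/u` gives the required summand up to the association of the product.
  general x = R.trans (expansion x) (∑-cong n λ k → R.*-congˡ {a k} (∑-cong k λ j → R.sym
    (R.*-assoc (binomial x j) (ƛ ^ (k ∸ j) * 1/ suc (k ∸ j) !) (degFalling 1ℝ (suc (k ∸ j)) ƛ⁻¹))))
  special : β n ƛ 0ℝ ≈ ∑[ k ≤ n ] a k * (ƛ ^ k * 1/ suc k !) * degFalling 1ℝ (suc k) ƛ⁻¹
  special = R.trans (expansion 0ℝ) (∑-cong n λ k → R.trans
    (R.*-congˡ {a k} (binomial-0-⊛ (t/u ƛ ƛ⁻¹) k))
    (R.sym (R.*-assoc (a k) (ƛ ^ k * 1/ suc k !) (degFalling 1ℝ (suc k) ƛ⁻¹))))
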